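{- There exists $r_0\in\mathbb{N}$ such that the following holds for every integer $r\geq r_0$: every finite simple graph $G$ with average degree $\mathrm{Ad}(G)\geq r^7 2^{3r+17}$ satisfies $\vec{\chi}_{\ell}(G)\geq r$.
   Context: $\mathrm{Ad}(G)$ denotes the average degree of $G$. An orientation of a graph $G$ is a digraph with underlying graph $G$ having at most one arc between each pair of vertices. A $k$-list assignment $L$ of a digraph $D$ assigns to each vertex $v$ a finite set $L(v)$ of at least $k$ positive integers. An $L$-dicolouring is a function $\varphi$ with $\varphi(v)\in L(v)$ for all $v$ such that each colour class induces a subdigraph with no directed cycle. The dichoosability $\vec{\chi}_{\ell}(D)$ is the least $k$ such that $D$ admits an $L$-dicolouring for every $k$-list assignment $L$ of $D$; for a graph $G$, $\vec{\chi}_{\ell}(G)$ is the maximum of $\vec{\chi}_{\ell}(D)$ over all orientations $D$ of $G$. -}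

module Defs where

open import Data.Nat using (ℕ; zero; suc; _+_; _*_; _^_; _≤_; _<_; _≥_)
open import Data.Fin using (Fin)
open import Data.Bool using (Bool; true; false; if_then_else_)
open import Data.List using (List; []; _∷_; length; map; allFin; last)
open import Data.Nat.ListAction using (sum)
open import Data.List.Membership.Propositional using (_∈_)
open import Data.List.Relation.Unary.All using (All)
open import Data.List.Relation.Unary.Unique.Propositional using (Unique)
open import Data.List.Relation.Unary.Linked using (Linked)
open import Data.Maybe using (just)
open import Data.Product using (Σ; _×_; ∃)
open import Data.Sum using (_⊎_)
open import Relation.Binary.PropositionalEquality using (_≡_; _≢_)
open import Relation.Nullary using (¬_)

record Graph : Set where
  field
    n     : ℕ
    adj   : Fin n → Fin n → Bool
    sym   : ∀ u v → adj u v ≡ adj v u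
    irrefl : ∀ v → adj v v ≡ false
open Graph public

deg : (G : Graph) → Fin (n G) → ℕ
deg G v = sum (map (λ u → if adj G v u then 1 else 0) (allFin (n G)))

degSum : Graph → ℕ
degSum G = sum (map (deg G) (allFin (n G)))

-- Ad(G) ≥ K, where Ad(G) = degSum(G) / |V(G)| (G has at least one vertex).
AdAtLeast : Graph → ℕ → Set
AdAtLeast G K = (0 < n G) × (K * n G ≤ degSum G)

Digraph : ℕ → Set
Digraph m = Fin m → Fin m → Bool

Arc : ∀ {m} → Digraph m → Fin m → Fin m → Set
Arc D u v = D u v ≡ true

IsOrientation : (G : Graph) → Digraph (n G) → Set
IsOrientation G D =
  (∀ u v → Arc D u v → adj G u v ≡ true) ×
  (∀ u v → adj G u v ≡ true → Arc D u v ⊎ Arc D v u) ×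
  (∀ u v → Arc D u v → ¬ Arc D v u)

record DirectedCycle {m : ℕ} (D : Digraph m) : Set where
  field
    first    : Fin m
    rest     : List (Fin m)
    distinct : Unique (first ∷ rest)
    path     : Linked (Arc D) (first ∷ rest)
    closing  : ∀ w → last (first ∷ rest) ≡ just w → Arc D w first
  vertices : List (Fin m)
  vertices = first ∷ rest

record ListAssignment {m : ℕ} (k : ℕ) : Set where
  field
    L        : Fin m → List ℕ
    nodup    : ∀ v → Unique (L v)
    positive : ∀ v → All (λ c → 0 < c) (L v)
    size     : ∀ v → k ≤ length (L v)
open ListAssignment public

IsLDicolouring : ∀ {m k} (D : Digraph m) → ListAssignment {m} k → (Fin m → ℕ) → Set
IsLDicolouring {m} D Λ φ =
  (∀ v → φ v ∈ L Λ v) ×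
  (∀ (c : ℕ) (C : DirectedCycle D) →
     ¬ All (λ v → φ v ≡ c) (DirectedCycle.vertices C))

Dichoosable : ∀ {m} → Digraph m → ℕ → Set
Dichoosable {m} D k = (Λ : ListAssignment {m} k) → ∃ λ φ → IsLDicolouring D Λ φ

-- χ⃗_ℓ(D) ≥ r : the least k with D k-dichoosable is at least r,
-- i.e. every k for which D is k-dichoosable satisfies k ≥ r.
DichoosabilityAtLeast : ∀ {m} → Digraph m → ℕ → Set
DichoosabilityAtLeast D r = ∀ k → Dichoosable D k → r ≤ k

-- χ⃗_ℓ(G) ≥ r : the maximum over orientations is at least r,
-- i.e. some orientation D of G has χ⃗_ℓ(D) ≥ r.
GraphDichoosabilityAtLeast : Graph → ℕ → Set
GraphDichoosabilityAtLeast G r =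
  Σ (Digraph (n G)) λ D → IsOrientation G D × DichoosabilityAtLeast D r

{-# OPTIONS --safe #-}
-- Put s = r - 1 and pass to a vertex set U whose induced subgraph has minimum degree at least half
-- of the average degree. A sparse random B ⊆ U gets random s-lists from a palette of q = 4s²
-- colours. Most vertices v of U outside B are then good: every half of the palette contains the
-- lists of many neighbours of v in B, and therefore, in each colouring of B, at least half of the
-- colours are frequent at v, i.e. occur on more than t neighbours of v in B. As B has far fewer
-- than |U| / 2^s vertices, random lists on the other vertices achieve that for each colouring of B
-- a fraction of about 2^-s of the good vertices has a list consisting of frequent colours only.
-- Hence every colouring from these lists has at least (2s + 6) |U| monochromatic edges inside U.
-- Finally, G is oriented at random. An acyclic orientation of a graph H is determined by its
-- outdegrees, so at most ∏ (deg v + 1) of the 2^e(H) orientations of H are acyclic. Since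
-- log₂ (deg v + 1) ≤ deg v / 4 + 2, the union bound over the s^|U| colourings of U leaves an
-- orientation in which every colouring from the lists has a monochromatic directed cycle.
-- Probabilities are counts over explicit lists of choice functions.
module Submission where

open import Defs hiding (n; sym; L; size)
open import Data.Bool using (Bool; true; false; if_then_else_; _∧_; _∨_; not; T; _xor_)
import Data.Bool as Bool
open import Data.Bool.ListAction using (all)
open import Data.Empty using (⊥; ⊥-elim)
open import Data.Fin using (Fin; zero; suc; toℕ; fromℕ<)
open import Data.Fin.Properties using (_≟_; toℕ-injective; injective⇒≤)
import Data.Fin.Properties as Fin
open import Data.List using (List; []; _∷_; _++_; length; map; allFin; concatMap; tabulate; last;
  upTo; lookup; replicate)
open import Data.List.Properties using (map-tabulate; map-++; map-∘; length-tabulate;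
  length-upTo; length-++; length-map; length-replicate)
open import Data.List.Membership.Propositional using (_∈_; find; lose)
open import Data.List.Membership.DecPropositional using (_∈?_)
open import Data.List.Membership.Propositional.Properties
open import Data.List.Relation.Unary.All using (All; []; _∷_)
import Data.List.Relation.Unary.All as All
import Data.List.Relation.Unary.All.Properties as Allₚ
open import Data.List.Relation.Unary.AllPairs using ([]; _∷_)
open import Data.List.Relation.Unary.Any using (here; there; any?)
open import Data.List.Relation.Unary.Linked using (Linked; []; [-]; _∷_)
open import Data.List.Relation.Unary.Unique.Propositional using (Unique)
import Data.List.Relation.Unary.Unique.Propositional.Properties as Unique
open import Data.Maybe using (Maybe; just; nothing; maybe′; is-just)
open import Data.Maybe.Properties using (just-injective)
open import Data.Nat hiding (_≟_)
open import Data.Nat.Combinatorics using (_C_; nCk+nC[k+1]≡[n+1]C[k+1]; nC1≡n; k>n⇒nCk≡0)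
open import Data.Nat.DivMod using (_/_; _%_; m≡m%n+[m/n]*n; m%n<n; m/n*n≤m)
open import Data.Nat.ListAction using (sum; product)
open import Data.Nat.ListAction.Properties using (sum-++)
open import Data.Nat.Properties hiding (_≟_)
import Data.Nat.Properties as ℕ
open import Data.Nat.Tactic.RingSolver using (solve-∀)
open import Data.Product using (Σ; ∃; _×_; _,_; proj₁; proj₂)
open import Data.Sum using (_⊎_; inj₁; inj₂)
open import Data.Vec.Functional using () renaming (_∷_ to _◂_)
open import Function using (_∘_; id)
open import Relation.Binary.PropositionalEquality
open import Relation.Nullary using (yes; no; ¬_; does; _×-dec_)

-- Finite sums, products and choice functions

∑ : {A : Set} → List A → (A → ℕ) → ℕ
∑ xs f = sum (map f xs)

∏ : {A : Set} → List A → (A → ℕ) → ℕ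
∏ xs f = product (map f xs)

𝟙 : Bool → ℕ
𝟙 b = if b then 1 else 0

𝟙≤1 : ∀ b → 𝟙 b ≤ 1
𝟙≤1 false = z≤n
𝟙≤1 true  = ≤-refl

𝟙-pos : ∀ b → 0 < 𝟙 b → b ≡ true
𝟙-pos true _ = refl

+-swap-mid : ∀ a b c d → (a + b) + (c + d) ≡ (a + c) + (b + d)
+-swap-mid = solve-∀

*-swap-mid : ∀ a b c d → (a * b) * (c * d) ≡ (a * c) * (b * d)
*-swap-mid = solve-∀

^-distrib-* : ∀ k a b → (a * b) ^ k ≡ a ^ k * b ^ k
^-distrib-* zero    a b = refl
^-distrib-* (suc k) a b =
  trans (cong (a * b *_) (^-distrib-* k a b)) (*-swap-mid a b (a ^ k) (b ^ k))

module _ {A : Set} where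

  ∑-cong : (xs : List A) {f g : A → ℕ} → (∀ x → f x ≡ g x) → ∑ xs f ≡ ∑ xs g
  ∑-cong []       e = refl
  ∑-cong (x ∷ xs) e = cong₂ _+_ (e x) (∑-cong xs e)

  ∑-mono∈ : (xs : List A) {f g : A → ℕ} → (∀ x → x ∈ xs → f x ≤ g x) → ∑ xs f ≤ ∑ xs g
  ∑-mono∈ []       e = z≤n
  ∑-mono∈ (x ∷ xs) e = +-mono-≤ (e x (here refl)) (∑-mono∈ xs λ y → e y ∘ there)

  ∑-mono : (xs : List A) {f g : A → ℕ} → (∀ x → f x ≤ g x) → ∑ xs f ≤ ∑ xs g
  ∑-mono xs e = ∑-mono∈ xs λ x _ → e x

  ∑-+ : (xs : List A) (f g : A → ℕ) → ∑ xs (λ x → f x + g x) ≡ ∑ xs f + ∑ xs g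
  ∑-+ []       f g = refl
  ∑-+ (x ∷ xs) f g =
    trans (cong (f x + g x +_) (∑-+ xs f g)) (+-swap-mid (f x) (g x) (∑ xs f) (∑ xs g))

  ∑-*ˡ : (xs : List A) (k : ℕ) (f : A → ℕ) → ∑ xs (λ x → k * f x) ≡ k * ∑ xs f
  ∑-*ˡ []       k f = sym (*-zeroʳ k)
  ∑-*ˡ (x ∷ xs) k f = trans (cong (k * f x +_) (∑-*ˡ xs k f)) (sym (*-distribˡ-+ k (f x) _))

  ∑-*ʳ : (xs : List A) (k : ℕ) (f : A → ℕ) → ∑ xs (λ x → f x * k) ≡ ∑ xs f * k
  ∑-*ʳ xs k f =
    trans (∑-cong xs λ x → *-comm (f x) k) (trans (∑-*ˡ xs k f) (*-comm k (∑ xs f)))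

  ∑-const : (xs : List A) (k : ℕ) → ∑ xs (λ _ → k) ≡ length xs * k
  ∑-const []       k = refl
  ∑-const (x ∷ xs) k = cong (k +_) (∑-const xs k)

  ∑-zero : (xs : List A) → ∑ xs (λ _ → 0) ≡ 0
  ∑-zero xs = trans (∑-const xs 0) (*-zeroʳ (length xs))

  ∑-length : (xs : List A) → ∑ xs (λ _ → 1) ≡ length xs
  ∑-length xs = trans (∑-const xs 1) (*-identityʳ _)

  ∑-++ : (xs ys : List A) (f : A → ℕ) → ∑ (xs ++ ys) f ≡ ∑ xs f + ∑ ys f
  ∑-++ xs ys f = trans (cong sum (map-++ f xs ys)) (sum-++ (map f xs) (map f ys))

  ∑-∈ : {xs : List A} (f : A → ℕ) {x : A} → x ∈ xs → f x ≤ ∑ xs f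
  ∑-∈ f (here refl)         = m≤m+n (f _) _
  ∑-∈ f (there {y} {xs} x∈) = ≤-trans (∑-∈ f x∈) (m≤n+m (∑ xs f) (f y))

  ∑-<⇒∃ : (xs : List A) (f g : A → ℕ) → ∑ xs f < ∑ xs g → ∃ λ x → x ∈ xs × f x < g x
  ∑-<⇒∃ (x ∷ xs) f g lt with f x <? g x
  ... | yes p = x , here refl , p
  ... | no ¬p with ∑-<⇒∃ xs f g (+-cancelˡ-< (g x) _ _ (≤-<-trans (+-monoˡ-≤ _ (≮⇒≥ ¬p)) lt))
  ...   | y , y∈ , p = y , there y∈ , p

  ∑-pos⇒∃ : (xs : List A) (f : A → ℕ) → 0 < ∑ xs f → ∃ λ x → x ∈ xs × 0 < f x
  ∑-pos⇒∃ xs f lt =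
    ∑-<⇒∃ xs (λ _ → 0) f (subst (_< ∑ xs f) (sym (∑-zero xs)) lt)

  ∏-cong : (xs : List A) {f g : A → ℕ} → (∀ x → f x ≡ g x) → ∏ xs f ≡ ∏ xs g
  ∏-cong []       e = refl
  ∏-cong (x ∷ xs) e = cong₂ _*_ (e x) (∏-cong xs e)

  ∏-mono : (xs : List A) {f g : A → ℕ} → (∀ x → f x ≤ g x) → ∏ xs f ≤ ∏ xs g
  ∏-mono []       e = ≤-refl
  ∏-mono (x ∷ xs) e = *-mono-≤ (e x) (∏-mono xs e)

  ∏-* : (xs : List A) (f g : A → ℕ) → ∏ xs (λ x → f x * g x) ≡ ∏ xs f * ∏ xs g
  ∏-* []       f g = refl
  ∏-* (x ∷ xs) f g =
    trans (cong (f x * g x *_) (∏-* xs f g)) (*-swap-mid (f x) (g x) (∏ xs f) (∏ xs g))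

  ∏-const : (xs : List A) (k : ℕ) → ∏ xs (λ _ → k) ≡ k ^ length xs
  ∏-const []       k = refl
  ∏-const (x ∷ xs) k = cong (k *_) (∏-const xs k)

  ∏-^ : (xs : List A) (k : ℕ) (f : A → ℕ) → ∏ xs (λ x → k ^ f x) ≡ k ^ ∑ xs f
  ∏-^ []       k f = refl
  ∏-^ (x ∷ xs) k f =
    trans (cong (k ^ f x *_) (∏-^ xs k f)) (sym (^-distribˡ-+-* k (f x) (∑ xs f)))

  ∏-^ʳ : (xs : List A) (k : ℕ) (f : A → ℕ) → ∏ xs (λ x → f x ^ k) ≡ ∏ xs f ^ k
  ∏-^ʳ []       k f = sym (^-zeroˡ k)
  ∏-^ʳ (x ∷ xs) k f =
    trans (cong (f x ^ k *_) (∏-^ʳ xs k f)) (sym (^-distrib-* k (f x) (∏ xs f)))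

  ∏-zero⇒∃ : (xs : List A) (f : A → ℕ) → ∏ xs f ≡ 0 → ∃ λ x → x ∈ xs × f x ≡ 0
  ∏-zero⇒∃ (x ∷ xs) f e with m*n≡0⇒m≡0∨n≡0 (f x) e
  ... | inj₁ p = x , here refl , p
  ... | inj₂ p = let y , y∈ , q = ∏-zero⇒∃ xs f p in y , there y∈ , q

∑-map : {A B : Set} (g : A → B) (xs : List A) (f : B → ℕ) → ∑ (map g xs) f ≡ ∑ xs (f ∘ g)
∑-map g xs f = cong sum (sym (map-∘ xs))

∑-swap : {A B : Set} (xs : List A) (ys : List B) (f : A → B → ℕ) →
         ∑ xs (λ x → ∑ ys (f x)) ≡ ∑ ys (λ y → ∑ xs (λ x → f x y))
∑-swap []       ys f = sym (∑-zero ys)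
∑-swap (x ∷ xs) ys f =
  trans (cong (∑ ys (f x) +_) (∑-swap xs ys f)) (sym (∑-+ ys (f x) (λ y → ∑ xs λ x → f x y)))

∑-concatMap : {A B : Set} (g : A → List B) (xs : List A) (f : B → ℕ) →
              ∑ (concatMap g xs) f ≡ ∑ xs (λ x → ∑ (g x) f)
∑-concatMap g []       f = refl
∑-concatMap g (x ∷ xs) f =
  trans (∑-++ (g x) (concatMap g xs) f) (cong (∑ (g x) f +_) (∑-concatMap g xs f))

map-allFin-suc : {B : Set} (n : ℕ) (f : Fin (suc n) → B) →
                 map f (tabulate suc) ≡ map (f ∘ suc) (allFin n)
map-allFin-suc n f = trans (map-tabulate suc f) (sym (map-tabulate id (f ∘ suc)))

∑-suc : (n : ℕ) (f : Fin (suc n) → ℕ) → ∑ (allFin (suc n)) f ≡ f zero + ∑ (allFin n) (f ∘ suc)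
∑-suc n f = cong (λ z → f zero + sum z) (map-allFin-suc n f)

∏-suc : (n : ℕ) (f : Fin (suc n) → ℕ) → ∏ (allFin (suc n)) f ≡ f zero * ∏ (allFin n) (f ∘ suc)
∏-suc n f = cong (λ z → f zero * product z) (map-allFin-suc n f)

length-allFin : ∀ n → length (allFin n) ≡ n
length-allFin n = length-tabulate {n = n} id

choices : {A : Set} (n : ℕ) → (Fin n → List A) → List (Fin n → A)
choices zero    o = (λ ()) ∷ []
choices (suc n) o = concatMap (λ x → map (x ◂_) (choices n (o ∘ suc))) (o zero)

module _ {A : Set} where

  ∑-choices-suc : (n : ℕ) (o : Fin (suc n) → List A) (F : (Fin (suc n) → A) → ℕ) →
    ∑ (choices (suc n) o) F ≡ ∑ (o zero) (λ x → ∑ (choices n (o ∘ suc)) (λ σ → F (x ◂ σ)))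
  ∑-choices-suc n o F = trans (∑-concatMap _ (o zero) F)
    (∑-cong (o zero) λ x → ∑-map (x ◂_) (choices n (o ∘ suc)) F)

  -- Independence: under a uniform choice function, the expectation of a product of one-coordinate
  -- weights is the product of their expectations. Every probability bound below rests on this
  -- factorisation.
  ∑-choices-∏ : (n : ℕ) (o : Fin n → List A) (w : Fin n → A → ℕ) →
    ∑ (choices n o) (λ σ → ∏ (allFin n) (λ v → w v (σ v))) ≡ ∏ (allFin n) (λ v → ∑ (o v) (w v))
  ∑-choices-∏ zero    o w = refl
  ∑-choices-∏ (suc n) o w = begin
      ∑ (choices (suc n) o) (λ σ → ∏ (allFin (suc n)) (λ v → w v (σ v)))
    ≡⟨ ∑-choices-suc n o _ ⟩
      ∑ (o zero) (λ x → ∑ rest λ σ → ∏ (allFin (suc n)) (λ v → w v ((x ◂ σ) v)))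
    ≡⟨ ∑-cong (o zero) (λ x → ∑-cong rest λ σ → ∏-suc n (λ v → w v ((x ◂ σ) v))) ⟩
      ∑ (o zero) (λ x → ∑ rest λ σ → w zero x * ∏ (allFin n) (λ v → w (suc v) (σ v)))
    ≡⟨ ∑-cong (o zero) (λ x → ∑-*ˡ rest (w zero x) _) ⟩
      ∑ (o zero) (λ x → w zero x * ∑ rest λ σ → ∏ (allFin n) (λ v → w (suc v) (σ v)))
    ≡⟨ ∑-*ʳ (o zero) _ (w zero) ⟩
      ∑ (o zero) (w zero) * ∑ rest (λ σ → ∏ (allFin n) (λ v → w (suc v) (σ v)))
    ≡⟨ cong (∑ (o zero) (w zero) *_) (∑-choices-∏ n (o ∘ suc) (w ∘ suc)) ⟩
      ∑ (o zero) (w zero) * ∏ (allFin n) (λ v → ∑ (o (suc v)) (w (suc v)))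
    ≡⟨ ∏-suc n (λ v → ∑ (o v) (w v)) ⟨
      ∏ (allFin (suc n)) (λ v → ∑ (o v) (w v))
    ∎
    where
    open ≡-Reasoning
    rest = choices n (o ∘ suc)

  length-choices : (n : ℕ) (o : Fin n → List A) →
    length (choices n o) ≡ ∏ (allFin n) (λ v → length (o v))
  length-choices n o = begin
      length (choices n o)
    ≡⟨ ∑-length (choices n o) ⟨
      ∑ (choices n o) (λ _ → 1)
    ≡⟨ ∑-cong (choices n o) (λ σ → sym (trans (∏-const (allFin n) 1) (^-zeroˡ (length (allFin n))))) ⟩
      ∑ (choices n o) (λ σ → ∏ (allFin n) (λ v → 1))
    ≡⟨ ∑-choices-∏ n o (λ _ _ → 1) ⟩
      ∏ (allFin n) (λ v → ∑ (o v) (λ _ → 1))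
    ≡⟨ ∏-cong (allFin n) (λ v → ∑-length (o v)) ⟩
      ∏ (allFin n) (λ v → length (o v))
    ∎
    where open ≡-Reasoning

  length-choices-const : (n : ℕ) (Ω : List A) → length (choices n (λ _ → Ω)) ≡ length Ω ^ n
  length-choices-const n Ω =
    trans (length-choices n (λ _ → Ω))
      (trans (∏-const (allFin n) (length Ω)) (cong (length Ω ^_) (length-allFin n)))

  ∈-choices⁻ : (n : ℕ) (o : Fin n → List A) {σ : Fin n → A} → σ ∈ choices n o → ∀ v → σ v ∈ o v
  ∈-choices⁻ (suc n) o σ∈ v with ∈-concat⁻′ (map _ (o zero)) σ∈
  ... | xs , σ∈xs , xs∈ with ∈-map⁻ _ xs∈
  ... | x , x∈ , refl with ∈-map⁻ (x ◂_) σ∈xs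
  ∈-choices⁻ (suc n) o σ∈ zero    | _ | x , x∈ , refl | τ , τ∈ , refl = x∈
  ∈-choices⁻ (suc n) o σ∈ (suc v) | _ | x , x∈ , refl | τ , τ∈ , refl =
    ∈-choices⁻ n (o ∘ suc) τ∈ v

  -- A listed function agrees with `φ` only pointwise, as functions with equal values need not be
  -- propositionally equal. The callers therefore transfer their statements along `σ v ≡ φ v`.
  choices-complete : (n : ℕ) (o : Fin n → List A) (φ : Fin n → A) → (∀ v → φ v ∈ o v) →
    ∃ λ σ → σ ∈ choices n o × (∀ v → σ v ≡ φ v)
  choices-complete zero    o φ φ∈ = _ , here refl , λ ()
  choices-complete (suc n) o φ φ∈ =
    let σ , σ∈ , e = choices-complete n (o ∘ suc) (φ ∘ suc) (φ∈ ∘ suc)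
    in φ zero ◂ σ
     , ∈-concat⁺′ (∈-map⁺ (φ zero ◂_) σ∈)
         (∈-map⁺ (λ x → map (x ◂_) (choices n (o ∘ suc))) (φ∈ zero))
     , λ { zero → refl ; (suc v) → e v }

  -- A single coordinate of a uniform choice is uniform on `Ω`. The factor `Q` expresses that an
  -- expectation is at most 1 / Q without fractions.
  ∑-choices-marginal : (n : ℕ) (Ω : List A) (Q : ℕ) (f : A → ℕ) → Q * ∑ Ω f ≤ length Ω →
    ∀ v → Q * ∑ (choices n (λ _ → Ω)) (λ σ → f (σ v)) ≤ length Ω ^ n
  ∑-choices-marginal (suc n) Ω Q f le zero = begin
      Q * ∑ (choices (suc n) (λ _ → Ω)) (λ σ → f (σ zero))
    ≡⟨ cong (Q *_) (∑-choices-suc n (λ _ → Ω) _) ⟩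
      Q * ∑ Ω (λ x → ∑ rest (λ _ → f x))
    ≡⟨ cong (Q *_) (∑-cong Ω λ x → trans (∑-const rest (f x)) (*-comm (length rest) (f x))) ⟩
      Q * ∑ Ω (λ x → f x * length rest)
    ≡⟨ cong (Q *_) (∑-*ʳ Ω (length rest) f) ⟩
      Q * (∑ Ω f * length rest)
    ≡⟨ *-assoc Q (∑ Ω f) (length rest) ⟨
      Q * ∑ Ω f * length rest
    ≤⟨ *-mono-≤ le (≤-reflexive (length-choices-const n Ω)) ⟩
      length Ω * length Ω ^ n
    ∎
    where
    open ≤-Reasoning
    rest = choices n (λ _ → Ω)
  ∑-choices-marginal (suc n) Ω Q f le (suc v) = begin
      Q * ∑ (choices (suc n) (λ _ → Ω)) (λ σ → f (σ (suc v)))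
    ≡⟨ cong (Q *_) (∑-choices-suc n (λ _ → Ω) _) ⟩
      Q * ∑ Ω (λ _ → ∑ (choices n (λ _ → Ω)) (λ σ → f (σ v)))
    ≡⟨ cong (Q *_) (∑-const Ω _) ⟩
      Q * (length Ω * ∑ (choices n (λ _ → Ω)) (λ σ → f (σ v)))
    ≡⟨ lem Q (length Ω) _ ⟩
      length Ω * (Q * ∑ (choices n (λ _ → Ω)) (λ σ → f (σ v)))
    ≤⟨ *-monoʳ-≤ (length Ω) (∑-choices-marginal n Ω Q f le v) ⟩
      length Ω * length Ω ^ n
    ∎
    where
    open ≤-Reasoning
    lem : ∀ a b c → a * (b * c) ≡ b * (a * c)
    lem = solve-∀

-- A lower tail bound

-- Bernoulli's inequality (1 + 1/a)^k ≥ 1 + k/a with the denominators cleared.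
bernoulli : ∀ a k → a ^ k * (a + k) ≤ a * suc a ^ k
bernoulli a zero    = ≤-reflexive (lem a)
  where
  lem : ∀ a → 1 * (a + 0) ≡ a * 1
  lem = solve-∀
bernoulli a (suc k) = begin
    a * a ^ k * (a + suc k)                 ≤⟨ m≤m+n _ (a ^ k * k) ⟩
    a * a ^ k * (a + suc k) + a ^ k * k     ≡⟨ lem a k (a ^ k) ⟩
    a ^ k * (a + k) * suc a                 ≤⟨ *-monoˡ-≤ (suc a) (bernoulli a k) ⟩
    a * suc a ^ k * suc a                   ≡⟨ lem₂ a (suc a ^ k) ⟩
    a * (suc a * suc a ^ k)                 ∎
  where
  open ≤-Reasoning
  lem : ∀ a k x → a * x * (a + (1 + k)) + x * k ≡ x * (a + k) * (1 + a)
  lem = solve-∀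
  lem₂ : ∀ a x → a * x * (1 + a) ≡ a * ((1 + a) * x)
  lem₂ = solve-∀

-- Bernoulli's inequality with exponent m + 1: (1 + 1/m)^(m+1) is at least (2m + 1)/m, which exceeds
-- 2.
halving : ∀ m → 2 * m ^ suc m ≤ suc m ^ suc m
halving zero      = z≤n
halving m@(suc _) = *-cancelˡ-≤ m (begin
    m * (2 * m ^ suc m)         ≤⟨ m≤m+n _ (m ^ suc m) ⟩
    m * (2 * m ^ suc m) + m ^ suc m ≡⟨ lem m (m ^ suc m) ⟩
    m ^ suc m * (m + suc m)     ≤⟨ bernoulli m (suc m) ⟩
    m * suc m ^ suc m           ∎)
  where
  open ≤-Reasoning
  lem : ∀ m x → m * (2 * x) + x ≡ x * (m + (1 + m))
  lem = solve-∀

-- Bounds (1 - 1/(m+1))^y by 2^-J: each block of m + 1 factors contributes one halving, and the `z`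
-- leftover factors are at most 1.
halving-iter : ∀ m J y → suc m * J ≤ y → m ^ y * 2 ^ J ≤ suc m ^ y
halving-iter m J y le with z , refl ← m≤n⇒∃[o]m+o≡n le = begin
    m ^ (suc m * J + z) * 2 ^ J             ≡⟨ cong (_* 2 ^ J) (^-distribˡ-+-* m (suc m * J) z) ⟩
    m ^ (suc m * J) * m ^ z * 2 ^ J         ≡⟨ cong (λ e → e * m ^ z * 2 ^ J) (^-*-assoc m (suc m) J) ⟨
    (m ^ suc m) ^ J * m ^ z * 2 ^ J         ≡⟨ lem ((m ^ suc m) ^ J) (m ^ z) (2 ^ J) ⟩
    2 ^ J * (m ^ suc m) ^ J * m ^ z         ≡⟨ cong (_* m ^ z) (^-distrib-* J 2 (m ^ suc m)) ⟨
    (2 * m ^ suc m) ^ J * m ^ z             ≤⟨ *-mono-≤ (^-monoˡ-≤ J (halving m)) (^-monoˡ-≤ z (n≤1+n m)) ⟩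
    (suc m ^ suc m) ^ J * suc m ^ z         ≡⟨ cong (_* suc m ^ z) (^-*-assoc (suc m) (suc m) J) ⟩
    suc m ^ (suc m * J) * suc m ^ z         ≡⟨ ^-distribˡ-+-* (suc m) (suc m * J) z ⟨
    suc m ^ (suc m * J + z)                 ∎
  where
  open ≤-Reasoning
  lem : ∀ a b c → a * b * c ≡ c * a * b
  lem = solve-∀

≤ᵇ-false : ∀ m n → (m ≤ᵇ n) ≡ false → n < m
≤ᵇ-false m n e = ≰⇒> λ le → subst T e (≤⇒≤ᵇ le)

≤ᵇ-true : ∀ m n → (m ≤ᵇ n) ≡ true → m ≤ n
≤ᵇ-true m n e = ≤ᵇ⇒≤ m n (subst T (sym e) _)

module LowerTail {A : Set} (n : ℕ) (Ω : List A) (Y : Fin n → Bool) (hit : Fin n → A → Bool) where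

  V : List (Fin n)
  V = allFin n

  hits : (Fin n → A) → ℕ
  hits σ = ∑ V λ u → 𝟙 (Y u ∧ hit u (σ u))

  size : ℕ
  size = ∑ V (𝟙 ∘ Y)

  -- This is 2 · 2^-[hit] on the coordinates in `Y`; the doubling keeps the weight a natural number,
  -- and `size` accounts for it later.
  weight : Fin n → A → ℕ
  weight u ω = if Y u then (if hit u ω then 1 else 2) else 1

  2^hits*∏weight : ∀ σ → 2 ^ hits σ * ∏ V (λ u → weight u (σ u)) ≡ 2 ^ size
  2^hits*∏weight σ = begin
      2 ^ hits σ * ∏ V (λ u → weight u (σ u))
    ≡⟨ cong (_* ∏ V (λ u → weight u (σ u))) (∏-^ V 2 _) ⟨
      ∏ V (λ u → 2 ^ 𝟙 (Y u ∧ hit u (σ u))) * ∏ V (λ u → weight u (σ u))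
    ≡⟨ ∏-* V _ _ ⟨
      ∏ V (λ u → 2 ^ 𝟙 (Y u ∧ hit u (σ u)) * weight u (σ u))
    ≡⟨ ∏-cong V (λ u → pointwise (Y u) (hit u (σ u))) ⟩
      ∏ V (λ u → 2 ^ 𝟙 (Y u))
    ≡⟨ ∏-^ V 2 _ ⟩
      2 ^ size
    ∎
    where
    open ≡-Reasoning
    pointwise : ∀ y h → 2 ^ 𝟙 (y ∧ h) * (if y then (if h then 1 else 2) else 1) ≡ 2 ^ 𝟙 y
    pointwise false h     = refl
    pointwise true  false = refl
    pointwise true  true  = refl

  -- The pointwise form of Markov's inequality: by `2^hits*∏weight` the right side equals 2^(R +
  -- size - hits), which is at least 2^size when there are at most `R` hits.
  few≤weight : ∀ R σ → 𝟙 (hits σ ≤ᵇ R) * 2 ^ size ≤ 2 ^ R * ∏ V (λ u → weight u (σ u))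
  few≤weight R σ with hits σ ≤ᵇ R in eq
  ... | false = z≤n
  ... | true  = begin
      1 * 2 ^ size                                ≡⟨ *-identityˡ _ ⟩
      2 ^ size                                    ≡⟨ 2^hits*∏weight σ ⟨
      2 ^ hits σ * ∏ V (λ u → weight u (σ u))     ≤⟨ *-monoˡ-≤ _ (^-monoʳ-≤ 2 (≤ᵇ-true (hits σ) R eq)) ⟩
      2 ^ R * ∏ V (λ u → weight u (σ u))          ∎
    where open ≤-Reasoning

  module _ (m : ℕ) (likely : ∀ u → Y u ≡ true → 2 * length Ω ≤ suc m * ∑ Ω (𝟙 ∘ hit u)) where

    -- The mean weight of a coordinate in `Y` is 2 minus its hit probability. As that probability is
    -- at least 2/(m+1), the mean is at most 2m/(m+1).
    ∑weight : ∀ u → suc m ^ 𝟙 (Y u) * ∑ Ω (weight u) ≤ (2 * m) ^ 𝟙 (Y u) * length Ω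
    ∑weight u with Y u in eq
    ... | false = ≤-reflexive (cong (_+ 0) (∑-length Ω))
    ... | true  = +-cancelʳ-≤ (2 * length Ω) _ _ (begin
        suc m * 1 * W + 2 * ℓ       ≤⟨ +-monoʳ-≤ (suc m * 1 * W) (likely u eq) ⟩
        suc m * 1 * W + suc m * H   ≡⟨ lem₁ m W H ⟩
        suc m * (W + H)             ≡⟨ cong (suc m *_) W+H ⟩
        suc m * (ℓ * 2)             ≡⟨ lem₂ m ℓ ⟩
        2 * m * 1 * ℓ + 2 * ℓ       ∎)
      where
      open ≤-Reasoning
      W = ∑ Ω λ ω → if hit u ω then 1 else 2
      H = ∑ Ω (𝟙 ∘ hit u)
      ℓ = length Ω
      two : ∀ b → (if b then 1 else 2) + 𝟙 b ≡ 2
      two false = refl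
      two true  = refl
      W+H : W + H ≡ ℓ * 2
      W+H = trans (sym (∑-+ Ω _ _)) (trans (∑-cong Ω (two ∘ hit u)) (∑-const Ω 2))
      lem₁ : ∀ m W H → (1 + m) * 1 * W + (1 + m) * H ≡ (1 + m) * (W + H)
      lem₁ = solve-∀
      lem₂ : ∀ m ℓ → (1 + m) * (ℓ * 2) ≡ 2 * m * 1 * ℓ + 2 * ℓ
      lem₂ = solve-∀

    ∑∏weight : suc m ^ size * ∑ (choices n (λ _ → Ω)) (λ σ → ∏ V (λ u → weight u (σ u)))
               ≤ (2 * m) ^ size * length Ω ^ n
    ∑∏weight = begin
        suc m ^ size * ∑ (choices n (λ _ → Ω)) (λ σ → ∏ V (λ u → weight u (σ u)))
      ≡⟨ cong (suc m ^ size *_) (∑-choices-∏ n (λ _ → Ω) weight) ⟩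
        suc m ^ size * ∏ V (λ u → ∑ Ω (weight u))
      ≡⟨ cong (_* ∏ V (λ u → ∑ Ω (weight u))) (∏-^ V (suc m) _) ⟨
        ∏ V (λ u → suc m ^ 𝟙 (Y u)) * ∏ V (λ u → ∑ Ω (weight u))
      ≡⟨ ∏-* V _ _ ⟨
        ∏ V (λ u → suc m ^ 𝟙 (Y u) * ∑ Ω (weight u))
      ≤⟨ ∏-mono V ∑weight ⟩
        ∏ V (λ u → (2 * m) ^ 𝟙 (Y u) * length Ω)
      ≡⟨ ∏-* V _ _ ⟩
        ∏ V (λ u → (2 * m) ^ 𝟙 (Y u)) * ∏ V (λ u → length Ω)
      ≡⟨ cong₂ _*_ (∏-^ V (2 * m) _)
           (trans (∏-const V (length Ω)) (cong (length Ω ^_) (length-allFin n))) ⟩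
        (2 * m) ^ size * length Ω ^ n
      ∎
      where open ≤-Reasoning

  -- Chernoff's method with the exponential weight 2^-hits.
  lower-tail : (κ R J : ℕ) → 0 < κ →
    (∀ u → Y u ≡ true → length Ω ≤ κ * ∑ Ω (𝟙 ∘ hit u)) →
    2 * κ * J ≤ size →
    ∑ (choices n (λ _ → Ω)) (λ σ → 𝟙 (hits σ ≤ᵇ R)) * 2 ^ J ≤ 2 ^ R * length Ω ^ n
  lower-tail κ@(suc κ′) R J _ likely J≤ = *-cancelˡ-≤ (2 ^ size) (*-cancelˡ-≤ (m ^ size) (begin
      m ^ size * (2 ^ size * (few * 2 ^ J))
    ≡⟨ lem₁ (m ^ size) (2 ^ size) few (2 ^ J) ⟩
      few * 2 ^ size * (m ^ size * 2 ^ J)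
    ≤⟨ *-mono-≤ few≤ (halving-iter m J size J≤) ⟩
      2 ^ R * S * suc m ^ size
    ≡⟨ lem₂ (2 ^ R) S (suc m ^ size) ⟩
      2 ^ R * (suc m ^ size * S)
    ≤⟨ *-monoʳ-≤ (2 ^ R) (∑∏weight m λ u Yu → ≤-trans (*-monoʳ-≤ 2 (likely u Yu))
         (≤-reflexive (sym (*-assoc 2 κ (∑ Ω (𝟙 ∘ hit u)))))) ⟩
      2 ^ R * ((2 * m) ^ size * length Ω ^ n)
    ≡⟨ cong (λ z → 2 ^ R * (z * length Ω ^ n)) (^-distrib-* size 2 m) ⟩
      2 ^ R * (2 ^ size * m ^ size * length Ω ^ n)
    ≡⟨ lem₃ (2 ^ R) (2 ^ size) (m ^ size) (length Ω ^ n) ⟩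
      m ^ size * (2 ^ size * (2 ^ R * length Ω ^ n))
    ∎))
    where
    open ≤-Reasoning
    -- Chosen so that `suc m` reduces to `2 * κ`: a hit probability of at least 1/κ is then the
    -- 2/(m+1) that `∑∏weight` asks for.
    m = κ′ + suc (κ′ + 0)
    instance
      m≢0 : NonZero m
      m≢0 = >-nonZero (≤-trans (s≤s z≤n) (m≤n+m (suc (κ′ + 0)) κ′))
      2^≢0 : NonZero (2 ^ size)
      2^≢0 = m^n≢0 2 size
      m^≢0 : NonZero (m ^ size)
      m^≢0 = m^n≢0 m size
    few = ∑ (choices n (λ _ → Ω)) λ σ → 𝟙 (hits σ ≤ᵇ R)
    S = ∑ (choices n (λ _ → Ω)) λ σ → ∏ V λ u → weight u (σ u)
    few≤ : few * 2 ^ size ≤ 2 ^ R * S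
    few≤ = begin
        few * 2 ^ size
      ≡⟨ ∑-*ʳ (choices n (λ _ → Ω)) (2 ^ size) _ ⟨
        ∑ (choices n (λ _ → Ω)) (λ σ → 𝟙 (hits σ ≤ᵇ R) * 2 ^ size)
      ≤⟨ ∑-mono (choices n (λ _ → Ω)) (few≤weight R) ⟩
        ∑ (choices n (λ _ → Ω)) (λ σ → 2 ^ R * ∏ V (λ u → weight u (σ u)))
      ≡⟨ ∑-*ˡ (choices n (λ _ → Ω)) (2 ^ R) _ ⟩
        2 ^ R * S
      ∎
    lem₁ : ∀ a b c d → a * (b * (c * d)) ≡ c * b * (a * d)
    lem₁ = solve-∀
    lem₂ : ∀ a b c → a * b * c ≡ a * (c * b)
    lem₂ = solve-∀
    lem₃ : ∀ a b c d → a * (b * c * d) ≡ c * (b * (a * d))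
    lem₃ = solve-∀

-- Binomial coefficients and lists of s-subsets

-- The identity (k+1) C(n, k+1) = (n-k) C(n, k) with the subtraction moved to the other side. It
-- follows from Pascal's rule by induction on `n`.
C-absorb : ∀ n k → suc k * (n C suc k) + k * (n C k) ≡ n * (n C k)
C-absorb zero    zero    = refl
C-absorb zero    (suc k)
  rewrite k>n⇒nCk≡0 {0} {suc (suc k)} (s≤s z≤n) | k>n⇒nCk≡0 {0} {suc k} (s≤s z≤n) =
  cong₂ _+_ (*-zeroʳ (suc (suc k))) (*-zeroʳ (suc k))
C-absorb (suc n) zero    = trans (+-identityʳ _) (trans (+-identityʳ _)
  (trans (nC1≡n (suc n)) (sym (*-identityʳ (suc n)))))
C-absorb (suc n) (suc k) = begin
    suc (suc k) * (suc n C suc (suc k)) + suc k * (suc n C suc k)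
  ≡⟨ cong₂ (λ x y → suc (suc k) * x + suc k * y)
       (nCk+nC[k+1]≡[n+1]C[k+1] n (suc k)) (nCk+nC[k+1]≡[n+1]C[k+1] n k) ⟨
    suc (suc k) * (b + c) + suc k * (a + b)
  ≡⟨ lem k a b c ⟩
    (suc (suc k) * c + suc k * b) + b + ((suc k * b + k * a) + a)
  ≡⟨ cong₂ (λ x y → x + b + (y + a)) (C-absorb n (suc k)) (C-absorb n k) ⟩
    n * b + b + (n * a + a)
  ≡⟨ lem₂ n a b ⟩
    suc n * (a + b)
  ≡⟨ cong (suc n *_) (nCk+nC[k+1]≡[n+1]C[k+1] n k) ⟩
    suc n * (suc n C suc k)
  ∎
  where
  open ≡-Reasoning
  a = n C k
  b = n C suc k
  c = n C suc (suc k)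
  lem : ∀ k a b c → (2 + k) * (b + c) + (1 + k) * (a + b)
                  ≡ ((2 + k) * c + (1 + k) * b) + b + (((1 + k) * b + k * a) + a)
  lem = solve-∀
  lem₂ : ∀ n a b → n * b + b + (n * a + a) ≡ (1 + n) * (a + b)
  lem₂ = solve-∀

C-step : ∀ j y → suc j * ((j + y) C suc j) ≡ y * ((j + y) C j)
C-step j y = +-cancelʳ-≡ (j * ((j + y) C j)) _ _
  (trans (C-absorb (j + y) j) (lem j y ((j + y) C j)))
  where
  lem : ∀ j y c → (j + y) * c ≡ y * c + j * c
  lem = solve-∀

C-monoˡ : ∀ {m n} k → m ≤ n → m C k ≤ n C k
C-monoˡ k m≤n = go (≤⇒≤′ m≤n)
  where
  step : ∀ n k → n C k ≤ suc n C k
  step n zero    = ≤-refl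
  step n (suc k) = ≤-trans (m≤n+m _ (n C k)) (≤-reflexive (nCk+nC[k+1]≡[n+1]C[k+1] n k))
  go : ∀ {m n} → m ≤′ n → m C k ≤ n C k
  go ≤′-refl     = ≤-refl
  go (≤′-step p) = ≤-trans (go p) (step _ k)

C-pos : ∀ {n k} → k ≤ n → 0 < n C k
C-pos {n} {zero} z≤n = s≤s z≤n
C-pos {suc n} {suc k} (s≤s p) =
  ≤-trans (C-pos p) (≤-trans (m≤m+n _ (n C suc k)) (≤-reflexive (nCk+nC[k+1]≡[n+1]C[k+1] n k)))

-- The factor s + i in the induction absorbs the loss accumulated over j draws.
C-halve : ∀ s h → 0 < s → 2 * (s * s) ≤ h → ((2 * h) C s) ≤ 2 ^ suc s * (h C s)
C-halve s@(suc _) h _ le = *-cancelʳ-≤ _ _ s (begin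
    ((2 * h) C s) * s                     ≡⟨ cong (((2 * h) C s) *_) (+-identityʳ s) ⟨
    ((2 * h) C s) * (s + 0)               ≤⟨ go s 0 (+-identityʳ s) ⟩
    2 ^ s * (h C s) * (2 * s)           ≡⟨ lem (2 ^ s) (h C s) s ⟩
    2 ^ suc s * (h C s) * s             ∎)
  where
  open ≤-Reasoning
  lem : ∀ a b s → a * b * (2 * s) ≡ 2 * a * b * s
  lem = solve-∀
  go : ∀ j i → j + i ≡ s → ((2 * h) C j) * (s + i) ≤ 2 ^ j * (h C j) * (2 * s)
  go zero i refl = ≤-reflexive (lem₀ i)
    where
    lem₀ : ∀ i → 1 * (i + i) ≡ 1 * 1 * (2 * i)
    lem₀ = solve-∀
  go (suc j) i e with Y , refl ← m≤n⇒∃[o]m+o≡n {j} {h}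
       (≤-trans (≤-trans (n≤1+n j) (≤-trans (m≤m+n _ i) (≤-reflexive e)))
         (≤-trans (m≤m*n s s) (≤-trans (m≤m+n (s * s) (s * s + 0)) le))) =
    *-cancelʳ-≤ _ _ (suc j * suc (s + i)) (begin
        ((2 * h) C suc j) * (s + i) * (suc j * suc (s + i))
      ≡⟨ lem₁ ((2 * h) C suc j) (s + i) j ⟩
        suc j * ((2 * h) C suc j) * (s + i) * suc (s + i)
      ≡⟨ cong (λ z → z * (s + i) * suc (s + i)) step₂ ⟩
        X * A * (s + i) * suc (s + i)
      ≡⟨ lem₂ X A (s + i) ⟩
        X * (s + i) * (A * suc (s + i))
      ≤⟨ *-mono-≤ X≤ (subst (λ z → A * z ≤ 2 ^ j * (h C j) * (2 * s)) (+-suc s i)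
           (go j (suc i) (trans (+-suc j i) e))) ⟩
        2 * Y * suc (s + i) * (2 ^ j * (h C j) * (2 * s))
      ≡⟨ lem₃ Y (s + i) (2 ^ j) (h C j) s ⟩
        2 * 2 ^ j * (Y * (h C j)) * (2 * s) * suc (s + i)
      ≡⟨ cong (λ z → 2 * 2 ^ j * z * (2 * s) * suc (s + i)) (C-step j Y) ⟨
        2 * 2 ^ j * (suc j * (h C suc j)) * (2 * s) * suc (s + i)
      ≡⟨ lem₄ (2 ^ j) j (h C suc j) s (s + i) ⟩
        2 ^ suc j * (h C suc j) * (2 * s) * (suc j * suc (s + i))
      ∎)
    where
    -- `X` is 2h - j and `Y` is h - j. Going from j to j + 1 multiplies the two binomials by X/(j+1)
    -- and Y/(j+1), so beyond the factor 2 the draw costs X/2Y. By `X≤` this is at most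
    -- (s+i+1)/(s+i), which is the drop of the factor s + i.
    X = 2 * Y + j
    A = (2 * (j + Y)) C j
    2h≡ : j + X ≡ 2 * (j + Y)
    2h≡ = l j Y
      where
      l : ∀ j Y → j + (2 * Y + j) ≡ 2 * (j + Y)
      l = solve-∀
    step₂ : suc j * ((2 * (j + Y)) C suc j) ≡ X * A
    step₂ = subst (λ z → suc j * (z C suc j) ≡ X * (z C j)) 2h≡ (C-step j X)
    j≤s : j ≤ s
    j≤s = ≤-trans (n≤1+n j) (≤-trans (m≤m+n _ i) (≤-reflexive e))
    i≤s : i ≤ s
    i≤s = ≤-trans (m≤n+m i (suc j)) (≤-reflexive e)
    -- Here the bound h ≥ 2s² enters: both j(s+i) and 2j are at most 2s², so together they are at
    -- most 2h = 2Y + 2j.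
    small : j * (s + i) ≤ 2 * Y
    small = +-cancelʳ-≤ (2 * j) _ _ (begin
        j * (s + i) + 2 * j             ≤⟨ +-mono-≤ (*-mono-≤ j≤s (+-monoʳ-≤ s i≤s)) (*-monoʳ-≤ 2 j≤s) ⟩
        s * (s + s) + 2 * s             ≤⟨ +-monoʳ-≤ (s * (s + s)) (*-monoʳ-≤ 2 (m≤m*n s s)) ⟩
        s * (s + s) + 2 * (s * s)       ≡⟨ l s ⟩
        2 * (2 * (s * s))               ≤⟨ *-monoʳ-≤ 2 le ⟩
        2 * (j + Y)                     ≡⟨ l₂ j Y ⟩
        2 * Y + 2 * j                   ∎)
      where
      l : ∀ s → s * (s + s) + 2 * (s * s) ≡ 2 * (2 * (s * s))
      l = solve-∀
      l₂ : ∀ j Y → 2 * (j + Y) ≡ 2 * Y + 2 * j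
      l₂ = solve-∀
    X≤ : X * (s + i) ≤ 2 * Y * suc (s + i)
    X≤ = begin
        (2 * Y + j) * (s + i)           ≡⟨ *-distribʳ-+ (s + i) (2 * Y) j ⟩
        2 * Y * (s + i) + j * (s + i)   ≤⟨ +-monoʳ-≤ (2 * Y * (s + i)) small ⟩
        2 * Y * (s + i) + 2 * Y         ≡⟨ l Y (s + i) ⟩
        2 * Y * suc (s + i)             ∎
      where
      l : ∀ Y z → 2 * Y * z + 2 * Y ≡ 2 * Y * (1 + z)
      l = solve-∀
    lem₁ : ∀ c z j → c * z * ((1 + j) * (1 + z)) ≡ (1 + j) * c * z * (1 + z)
    lem₁ = solve-∀
    lem₂ : ∀ X A z → X * A * z * (1 + z) ≡ X * z * (A * (1 + z))
    lem₂ = solve-∀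
    lem₃ : ∀ Y z p c s → 2 * Y * (1 + z) * (p * c * (2 * s)) ≡ 2 * p * (Y * c) * (2 * s) * (1 + z)
    lem₃ = solve-∀
    lem₄ : ∀ p j c s z → 2 * p * ((1 + j) * c) * (2 * s) * (1 + z)
                       ≡ 2 * p * c * (2 * s) * ((1 + j) * (1 + z))
    lem₄ = solve-∀

combs : {A : Set} → ℕ → List A → List (List A)
combs zero    xs       = [] ∷ []
combs (suc s) []       = []
combs (suc s) (x ∷ xs) = map (x ∷_) (combs s xs) ++ combs (suc s) xs

module _ {A : Set} where

  -- The sublists inside `p` are those of the entries satisfying `p`. When the head satisfies `p`,
  -- keeping or dropping it is Pascal's rule.
  ∑-combs : (p : A → Bool) (s : ℕ) (xs : List A) →
            ∑ (combs s xs) (𝟙 ∘ all p) ≡ ∑ xs (𝟙 ∘ p) C s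
  ∑-combs p zero    xs       = refl
  ∑-combs p (suc s) []       = sym (k>n⇒nCk≡0 {0} {suc s} (s≤s z≤n))
  ∑-combs p (suc s) (x ∷ xs)
    rewrite ∑-++ (map (x ∷_) (combs s xs)) (combs (suc s) xs) (𝟙 ∘ all p)
          | ∑-map (x ∷_) (combs s xs) (𝟙 ∘ all p)
          | ∑-combs p (suc s) xs
    with p x
  ... | false rewrite ∑-const (combs s xs) 0 | *-zeroʳ (length (combs s xs)) = refl
  ... | true  rewrite ∑-combs p s xs = nCk+nC[k+1]≡[n+1]C[k+1] _ s

  length-combs : (s : ℕ) (xs : List A) → length (combs s xs) ≡ length xs C s
  length-combs s xs = begin
      length (combs s xs)                     ≡⟨ ∑-length (combs s xs) ⟨
      ∑ (combs s xs) (λ _ → 1)                ≡⟨ ∑-cong (combs s xs) (sym ∘ all-true) ⟩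
      ∑ (combs s xs) (𝟙 ∘ all (λ _ → true))   ≡⟨ ∑-combs (λ _ → true) s xs ⟩
      ∑ xs (λ _ → 1) C s                      ≡⟨ cong (_C s) (∑-length xs) ⟩
      length xs C s                           ∎
    where
    open ≡-Reasoning
    all-true : ∀ S → 𝟙 (all (λ _ → true) S) ≡ 1
    all-true []      = refl
    all-true (_ ∷ S) = all-true S

  combs-All : {P : A → Set} (s : ℕ) {xs S : List A} → S ∈ combs s xs → All P xs → All P S
  combs-All zero    (here refl) _ = []
  combs-All (suc s) {x ∷ xs} S∈ (px ∷ pxs) with ∈-++⁻ (map (x ∷_) (combs s xs)) S∈
  ... | inj₂ S∈′ = combs-All (suc s) S∈′ pxs
  ... | inj₁ S∈′ with _ , R∈ , refl ← ∈-map⁻ (x ∷_) S∈′ = px ∷ combs-All s R∈ pxs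

  combs-length : (s : ℕ) {xs S : List A} → S ∈ combs s xs → length S ≡ s
  combs-length zero    (here refl) = refl
  combs-length (suc s) {x ∷ xs} S∈ with ∈-++⁻ (map (x ∷_) (combs s xs)) S∈
  ... | inj₂ S∈′ = combs-length (suc s) {xs} S∈′
  ... | inj₁ S∈′ with _ , R∈ , refl ← ∈-map⁻ (x ∷_) S∈′ = cong suc (combs-length s {xs} R∈)

  combs-Unique : (s : ℕ) {xs S : List A} → S ∈ combs s xs → Unique xs → Unique S
  combs-Unique zero    (here refl) _ = []
  combs-Unique (suc s) {x ∷ xs} S∈ (px ∷ pxs) with ∈-++⁻ (map (x ∷_) (combs s xs)) S∈
  ... | inj₂ S∈′ = combs-Unique (suc s) S∈′ pxs
  ... | inj₁ S∈′ with _ , R∈ , refl ← ∈-map⁻ (x ∷_) S∈′ = combs-All s R∈ px ∷ combs-Unique s R∈ pxs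

-- Directed cycles and outdegree sequences

lookup-injective : {A : Set} {xs : List A} → Unique xs → ∀ {i j} → lookup xs i ≡ lookup xs j → i ≡ j
lookup-injective {xs = _ ∷ xs} (x∉ ∷ un) {zero}  {zero}  e = refl
lookup-injective {xs = _ ∷ xs} (x∉ ∷ un) {zero}  {suc j} e = ⊥-elim (All.lookup x∉ (∈-lookup j) e)
lookup-injective {xs = _ ∷ xs} (x∉ ∷ un) {suc i} {zero}  e = ⊥-elim (All.lookup x∉ (∈-lookup i) (sym e))
lookup-injective {xs = _ ∷ xs} (x∉ ∷ un) {suc i} {suc j} e = cong suc (lookup-injective un e)

module _ {m : ℕ} {D : Digraph m} where

  -- Cuts a path at `y`, so that an arc from `y` back to `x` closes it to a cycle. The transfer of
  -- `All` is polymorphic because it serves both the distinctness of the vertices and their common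
  -- colour.
  prefix : ∀ {x xs y} → y ∈ x ∷ xs → Unique (x ∷ xs) → Linked (Arc D) (x ∷ xs) →
    ∃ λ ys → (∀ {P : Fin m → Set} → All P (x ∷ xs) → All P (x ∷ ys)) ×
             Unique (x ∷ ys) × Linked (Arc D) (x ∷ ys) × last (x ∷ ys) ≡ just y
  prefix (here refl) _ _ = [] , (λ { (p ∷ _) → p ∷ [] }) , [] ∷ [] , [-] , refl
  prefix {xs = _ ∷ _} (there y∈) (x∉ ∷ un) (a ∷ li) =
    let ys , all⇒ , un′ , li′ , la = prefix y∈ un li
    in _ ∷ ys , (λ { (p ∷ ps) → p ∷ all⇒ ps }) , all⇒ x∉ ∷ un′ , a ∷ li′ , la

  close : ∀ {x xs y} → y ∈ x ∷ xs → Arc D y x → Unique (x ∷ xs) → Linked (Arc D) (x ∷ xs) →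
    Σ (DirectedCycle D) λ Γ → ∀ {P : Fin m → Set} → All P (x ∷ xs) → All P (DirectedCycle.vertices Γ)
  close {x} {y = y} y∈ a un li =
    let ys , all⇒ , un′ , li′ , la = prefix y∈ un li
    in record { first = x ; rest = ys ; distinct = un′ ; path = li′
              ; closing = λ w e → subst (λ z → Arc D z x) (just-injective (trans (sym la) e)) a }
     , all⇒

  module _ (R : Fin m → Fin m → Set) (R⇒Arc : ∀ {x y} → R x y → Arc D x y)
           (back : ∀ {x y} → R x y → ∃ λ w → R w x)
           {P : Fin m → Set} (P-back : ∀ {x y} → R x y → P y → P x) where

    -- The path grows at its head by predecessors until a predecessor is already on it. `fuel`
    -- bounds the remaining extensions: at `zero` the path would consist of m + 1 distinct vertices
    -- among m. The successor in `∃ (R x)` is what lets `back` supply the next predecessor.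
    backward-walk : ∀ fuel x xs → fuel + length xs ≡ m → ∃ (R x) →
      Unique (x ∷ xs) → Linked (Arc D) (x ∷ xs) → All P (x ∷ xs) →
      Σ (DirectedCycle D) λ Γ → All P (DirectedCycle.vertices Γ)
    backward-walk zero x xs e _ un _ _ =
      ⊥-elim (1+n≰n (≤-trans (injective⇒≤ (lookup-injective un)) (≤-reflexive (sym e))))
    backward-walk (suc fuel) x xs e (_ , r) un li al with back r
    ... | w , q with _∈?_ _≟_ w (x ∷ xs)
    ... | yes w∈ = let Γ , all⇒ = close w∈ (R⇒Arc q) un li in Γ , all⇒ al
    ... | no w∉ = backward-walk fuel w (x ∷ xs) (trans (+-suc fuel (length xs)) e) (x , q)
                    (Allₚ.¬Any⇒All¬ (x ∷ xs) w∉ ∷ un) (R⇒Arc q ∷ li) (P-back q (lookup₀ al) ∷ al)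
      where
      lookup₀ : ∀ {y ys} → All P (y ∷ ys) → P y
      lookup₀ (p ∷ _) = p

    cycle : ∀ {x y} → R x y → P x → Σ (DirectedCycle D) λ Γ → All P (DirectedCycle.vertices Γ)
    cycle {x} r p = backward-walk m x [] (+-identityʳ m) (_ , r) ([] ∷ []) [-] (p ∷ [])

Bits : ℕ → Set
Bits n = Fin n → Fin n → Bool

-- The bit χ u v orients the edge H u v as u → v if true and as v → u if false.
module _ {n : ℕ} (H : Fin n → Fin n → Bool) where

  private
    V : List (Fin n)
    V = allFin n

  outdeg : Bits n → Fin n → ℕ
  outdeg χ v = ∑ V λ u → 𝟙 (H v u ∧ χ v u) + 𝟙 (H u v ∧ not (χ u v))

  degree : Fin n → ℕ
  degree v = ∑ V λ u → 𝟙 (H v u) + 𝟙 (H u v)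

  edges : ℕ
  edges = ∑ V λ u → ∑ V λ v → 𝟙 (H u v)

  outdeg≤degree : ∀ χ v → outdeg χ v ≤ degree v
  outdeg≤degree χ v = ∑-mono V λ u → +-mono-≤ (le (H v u) _) (le (H u v) _)
    where
    le : ∀ a b → 𝟙 (a ∧ b) ≤ 𝟙 a
    le false b = z≤n
    le true  b = 𝟙≤1 b

  ∑degree : ∑ V degree ≡ 2 * edges
  ∑degree = begin
      ∑ V (λ v → ∑ V λ u → 𝟙 (H v u) + 𝟙 (H u v))
    ≡⟨ ∑-cong V (λ v → ∑-+ V _ _) ⟩
      ∑ V (λ v → ∑ V (λ u → 𝟙 (H v u)) + ∑ V (λ u → 𝟙 (H u v)))
    ≡⟨ ∑-+ V _ _ ⟩
      edges + ∑ V (λ v → ∑ V (λ u → 𝟙 (H u v)))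
    ≡⟨ cong (edges +_) (∑-swap V V λ v u → 𝟙 (H u v)) ⟩
      edges + edges
    ≡⟨ cong (edges +_) (+-identityʳ edges) ⟨
      2 * edges
    ∎
    where open ≡-Reasoning

  -- Agreement on the edges of `H`, with the bits elsewhere left free. It is written as a product
  -- over pairs so that its sum over all bit matrices factorises.
  agree : Bits n → Bits n → ℕ
  agree χ χ′ = ∏ V λ u → ∏ V λ v → 𝟙 (not (H u v ∧ (χ u v xor χ′ u v)))

  disagree⇒∃ : ∀ χ χ′ → agree χ χ′ ≡ 0 →
    ∃ λ u → ∃ λ v → H u v ≡ true × (χ u v xor χ′ u v) ≡ true
  disagree⇒∃ χ χ′ e =
    let u , _ , e₁ = ∏-zero⇒∃ V _ e
        v , _ , e₂ = ∏-zero⇒∃ V _ e₁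
    in u , v , bool (H u v) _ e₂
    where
    bool : ∀ a b → 𝟙 (not (a ∧ b)) ≡ 0 → a ≡ true × b ≡ true
    bool true true _ = refl , refl

  -- Indicates an arc x → y of the orientation `χ` that `χ′` reverses. The two terms cover the two
  -- orders in which `H` may store the edge.
  flip-arc : Bits n → Bits n → Fin n → Fin n → ℕ
  flip-arc χ χ′ x y = 𝟙 (H x y ∧ (χ x y ∧ not (χ′ x y))) + 𝟙 (H y x ∧ (not (χ y x) ∧ χ′ y x))

  -- Passing from `χ` to `χ′`, each reversed arc entering `v` raises its outdegree by one and each
  -- reversed arc leaving `v` lowers it by one. Equal outdegrees therefore force balance; the
  -- identity is checked pair by pair on truth values.
  flip-balanced : ∀ χ χ′ → (∀ v → outdeg χ v ≡ outdeg χ′ v) → ∀ v →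
    ∑ V (λ u → flip-arc χ χ′ u v) ≡ ∑ V (flip-arc χ χ′ v)
  flip-balanced χ χ′ same v = +-cancelˡ-≡ (outdeg χ v) _ _ (begin
      outdeg χ v + ∑ V (λ u → flip-arc χ χ′ u v)
    ≡⟨ ∑-+ V _ _ ⟨
      ∑ V (λ u → 𝟙 (H v u ∧ χ v u) + 𝟙 (H u v ∧ not (χ u v)) + flip-arc χ χ′ u v)
    ≡⟨ ∑-cong V (λ u → bool (H v u) (χ v u) (χ′ v u) (H u v) (χ u v) (χ′ u v)) ⟩
      ∑ V (λ u → 𝟙 (H v u ∧ χ′ v u) + 𝟙 (H u v ∧ not (χ′ u v)) + flip-arc χ χ′ v u)
    ≡⟨ ∑-+ V _ _ ⟩
      outdeg χ′ v + ∑ V (flip-arc χ χ′ v)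
    ≡⟨ cong (_+ ∑ V (flip-arc χ χ′ v)) (same v) ⟨
      outdeg χ v + ∑ V (flip-arc χ χ′ v)
    ∎)
    where
    open ≡-Reasoning
    bool₁ : ∀ h b b′ → 𝟙 (h ∧ b) + 𝟙 (h ∧ (not b ∧ b′)) ≡ 𝟙 (h ∧ b′) + 𝟙 (h ∧ (b ∧ not b′))
    bool₁ false b     b′    = refl
    bool₁ true  false false = refl
    bool₁ true  false true  = refl
    bool₁ true  true  false = refl
    bool₁ true  true  true  = refl
    bool₂ : ∀ h b b′ →
      𝟙 (h ∧ not b) + 𝟙 (h ∧ (b ∧ not b′)) ≡ 𝟙 (h ∧ not b′) + 𝟙 (h ∧ (not b ∧ b′))
    bool₂ false b     b′    = refl
    bool₂ true  false false = refl
    bool₂ true  false true  = refl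
    bool₂ true  true  false = refl
    bool₂ true  true  true  = refl
    lem : ∀ a b c d → (a + b) + (c + d) ≡ (a + d) + (b + c)
    lem = solve-∀
    bool : ∀ h b b′ k c c′ →
      (𝟙 (h ∧ b) + 𝟙 (k ∧ not c)) + (𝟙 (k ∧ (c ∧ not c′)) + 𝟙 (h ∧ (not b ∧ b′))) ≡
      (𝟙 (h ∧ b′) + 𝟙 (k ∧ not c′)) + (𝟙 (h ∧ (b ∧ not b′)) + 𝟙 (k ∧ (not c ∧ c′)))
    bool h b b′ k c c′ = trans (lem (𝟙 (h ∧ b)) _ _ _)
      (trans (cong₂ _+_ (bool₁ h b b′) (bool₂ k c c′)) (+-swap-mid (𝟙 (h ∧ b′)) _ _ _))

  -- An acyclic orientation is determined by its outdegrees: the arcs reversed in another orientation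
  -- with the same outdegrees form a balanced digraph.
  monochromatic-cycle : (D : Digraph n) {P : Fin n → Set} (χ χ′ : Bits n) →
    (∀ {u v} → H u v ≡ true → χ u v ≡ true → Arc D u v) →
    (∀ {u v} → H u v ≡ true → χ u v ≡ false → Arc D v u) →
    (∀ {u v} → H u v ≡ true → P u → P v) → (∀ {u v} → H u v ≡ true → P v → P u) →
    (∀ v → outdeg χ v ≡ outdeg χ′ v) →
    ∀ {u v} → H u v ≡ true → (χ u v xor χ′ u v) ≡ true → P u →
    Σ (DirectedCycle D) λ Γ → All P (DirectedCycle.vertices Γ)
  monochromatic-cycle D {P} χ χ′ fwd bwd P→ P← same {u} {v} Huv diff Pu =
    start (χ u v) (χ′ u v) refl refl diff
    where
    R : Fin n → Fin n → Set
    R x y = 0 < flip-arc χ χ′ x y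
    split : ∀ a b a′ b′ {c c′} → 0 < 𝟙 (a ∧ (b ∧ c)) + 𝟙 (a′ ∧ (not b′ ∧ c′)) →
      (a ≡ true × b ≡ true) ⊎ (a′ ≡ true × b′ ≡ false)
    split true  true  a′   b′    _  = inj₁ (refl , refl)
    split true  false true false _  = inj₂ (refl , refl)
    split false b     true false _  = inj₂ (refl , refl)
    R⇒ : ∀ {x y} → R x y →
      (H x y ≡ true × χ x y ≡ true) ⊎ (H y x ≡ true × χ y x ≡ false)
    R⇒ {x} {y} = split (H x y) (χ x y) (H y x) (χ y x)
    R⇒Arc : ∀ {x y} → R x y → Arc D x y
    R⇒Arc r with R⇒ r
    ... | inj₁ (h , c) = fwd h c
    ... | inj₂ (h , c) = bwd h c
    -- A reversed arc leaves `x`, so by balance one also enters `x`.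
    back : ∀ {x y} → R x y → ∃ λ w → R w x
    back {x} {y} r =
      let w , _ , q = ∑-pos⇒∃ V (λ u → flip-arc χ χ′ u x)
                        (subst (0 <_) (sym (flip-balanced χ χ′ same x))
                          (≤-trans r (∑-∈ (flip-arc χ χ′ x) (∈-allFin y))))
      in w , q
    P-back : ∀ {x y} → R x y → P y → P x
    P-back r with R⇒ r
    ... | inj₁ (h , _) = P← h
    ... | inj₂ (h , _) = P→ h
    start : ∀ b b′ → χ u v ≡ b → χ′ u v ≡ b′ → (b xor b′) ≡ true →
      Σ (DirectedCycle D) λ Γ → All P (DirectedCycle.vertices Γ)
    start true false e e′ _ = cycle R R⇒Arc back P-back {u} {v} pos Pu
      where
      pos : R u v
      pos rewrite Huv | e | e′ = s≤s z≤n
    start false true e e′ _ = cycle R R⇒Arc back P-back {v} {u} pos (P→ Huv Pu)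
      where
      pos : R v u
      pos rewrite Huv | e | e′ = m≤n+m 1 _

-- Counting orientations by outdegree sequences

module _ (n : ℕ) where

  private
    V : List (Fin n)
    V = allFin n

  all-bits : List (Bits n)
  all-bits = choices n λ _ → choices n λ _ → true ∷ false ∷ []

  length-all-bits : length all-bits ≡ (2 ^ n) ^ n
  length-all-bits = trans (length-choices-const n _) (cong (_^ n) (length-choices-const n _))

  -- An edge of `H` admits one of the two bits and a non-edge admits both, so exactly a 2^-e(H)
  -- fraction of the bit matrices agrees with `χ′` on `H`.
  ∑agree : ∀ H χ′ → ∑ all-bits (λ χ → agree H χ χ′) * 2 ^ edges H ≡ length all-bits
  ∑agree H χ′ = begin
      ∑ all-bits (λ χ → agree H χ χ′) * 2 ^ edges H
    ≡⟨ cong (_* 2 ^ edges H) (trans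
         (∑-choices-∏ n (λ _ → choices n λ _ → true ∷ false ∷ []) λ u row → ∏ V λ v → w u v (row v))
         (∏-cong V λ u → ∑-choices-∏ n (λ _ → true ∷ false ∷ []) (w u))) ⟩
      ∏ V (λ u → ∏ V λ v → ∑ (true ∷ false ∷ []) (w u v)) * 2 ^ edges H
    ≡⟨ cong (∏ V (λ u → ∏ V λ v → ∑ (true ∷ false ∷ []) (w u v)) *_)
         (trans (∏-cong V λ u → ∏-^ V 2 _) (∏-^ V 2 _)) ⟨
      ∏ V (λ u → ∏ V λ v → ∑ (true ∷ false ∷ []) (w u v)) * ∏ V (λ u → ∏ V λ v → 2 ^ 𝟙 (H u v))
    ≡⟨ ∏-* V _ _ ⟨
      ∏ V (λ u → ∏ V (λ v → ∑ (true ∷ false ∷ []) (w u v)) * ∏ V λ v → 2 ^ 𝟙 (H u v))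
    ≡⟨ ∏-cong V (λ u → trans (sym (∏-* V _ _)) (∏-cong V λ v → bool (H u v) (χ′ u v))) ⟩
      ∏ V (λ u → ∏ V λ v → 2)
    ≡⟨ trans (∏-cong V λ _ → power 2) (power (2 ^ n)) ⟩
      (2 ^ n) ^ n
    ≡⟨ length-all-bits ⟨
      length all-bits
    ∎
    where
    open ≡-Reasoning
    w : Fin n → Fin n → Bool → ℕ
    w u v b = 𝟙 (not (H u v ∧ (b xor χ′ u v)))
    bool : ∀ h c → ∑ (true ∷ false ∷ []) (λ b → 𝟙 (not (h ∧ (b xor c)))) * 2 ^ 𝟙 h ≡ 2
    bool false c     = refl
    bool true  false = refl
    bool true  true  = refl
    power : ∀ k → ∏ V (λ _ → k) ≡ k ^ n
    power k = trans (∏-const V k) (cong (k ^_) (length-allFin n))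

  module _ (H : Fin n → Fin n → Bool) where

    outdegrees : List (Fin n → ℕ)
    outdegrees = choices n λ v → upTo (suc (degree H v))

    length-outdegrees : length outdegrees ≡ ∏ V (suc ∘ degree H)
    length-outdegrees = trans (length-choices n _) (∏-cong V λ v → length-upTo (suc (degree H v)))

    -- One bit matrix per outdegree sequence. An acyclic orientation has to agree on `H` with the
    -- representative of its own sequence, so disagreement certifies a cycle. The constant matrix
    -- stands in for sequences that no orientation realises.
    representative : (Fin n → ℕ) → Bits n
    representative o with any? (λ χ → Fin.all? λ v → outdeg H χ v ℕ.≟ o v) all-bits
    ... | yes p = proj₁ (find p)
    ... | no  _ = λ _ _ → true

    outdeg-representative : ∀ o {χ} → χ ∈ all-bits → (∀ v → outdeg H χ v ≡ o v) →
      ∀ v → outdeg H (representative o) v ≡ o v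
    outdeg-representative o χ∈ e with any? (λ χ → Fin.all? λ v → outdeg H χ v ℕ.≟ o v) all-bits
    ... | yes p = proj₂ (proj₂ (find p))
    ... | no ¬p = ⊥-elim (¬p (lose χ∈ e))

  -- Union bound over the pairs (i , outdegree sequence), each of which forbids a single
  -- orientation of H i.
  non-rigid-bits : {I : Set} (is : List I) (H : I → Fin n → Fin n → Bool) →
    (∀ i → i ∈ is → suc (length is) * ∏ V (suc ∘ degree (H i)) ≤ 2 ^ edges (H i)) →
    ∃ λ χ → ∀ i → i ∈ is → ∃ λ χ′ → (∀ v → outdeg (H i) χ v ≡ outdeg (H i) χ′ v) ×
      ∃ λ u → ∃ λ v → H i u v ≡ true × (χ u v xor χ′ u v) ≡ true
  non-rigid-bits {I} is H few =
    let χ , χ∈ , lt = ∑-<⇒∃ all-bits bad (λ _ → 1)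
          (subst (∑ all-bits bad <_) (sym (∑-length all-bits)) ∑bad<)
    in χ , λ i i∈ →
      let o , o∈ , e = choices-complete n (λ v → upTo (suc (degree (H i) v))) (outdeg (H i) χ)
                         (λ v → ∈-upTo⁺ (s≤s (outdeg≤degree (H i) χ v)))
          same = outdeg-representative (H i) o χ∈ (sym ∘ e)
          -- The total count of agreements at `χ` is below 1, so each of its summands vanishes, in
          -- particular the one for this `i` and the sequence of `χ`.
          z = n≤0⇒n≡0 (≤-trans (∑-∈ (λ o → agree (H i) χ (representative (H i) o)) o∈)
                (≤-trans
                  (∑-∈ (λ i → ∑ (outdegrees (H i)) λ o → agree (H i) χ (representative (H i) o)) i∈)
                  (s≤s⁻¹ lt)))
      in representative (H i) o , (λ v → trans (sym (e v)) (sym (same v)))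
       , disagree⇒∃ (H i) χ (representative (H i) o) z
    where
    open ≤-Reasoning
    bad : Bits n → ℕ
    bad χ = ∑ is λ i → ∑ (outdegrees (H i)) λ o → agree (H i) χ (representative (H i) o)
    bad-i : I → ℕ
    bad-i i = ∑ (outdegrees (H i)) λ o → ∑ all-bits λ χ → agree (H i) χ (representative (H i) o)
    T₀ = length all-bits
    T₀>0 : 0 < T₀
    T₀>0 = subst (0 <_) (sym length-all-bits) (m^n>0 (2 ^ n) {{m^n≢0 2 n}} n)
    bad-i≤ : ∀ i → i ∈ is → suc (length is) * bad-i i ≤ T₀
    bad-i≤ i i∈ = *-cancelʳ-≤ _ _ (2 ^ edges (H i)) {{m^n≢0 2 (edges (H i))}} (begin
        suc (length is) * bad-i i * 2 ^ edges (H i)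
      ≡⟨ *-assoc (suc (length is)) (bad-i i) _ ⟩
        suc (length is) * (bad-i i * 2 ^ edges (H i))
      ≡⟨ cong (suc (length is) *_) (trans (sym (∑-*ʳ (outdegrees (H i)) (2 ^ edges (H i)) _))
           (trans (∑-cong (outdegrees (H i)) λ o → ∑agree (H i) (representative (H i) o))
             (∑-const (outdegrees (H i)) T₀))) ⟩
        suc (length is) * (length (outdegrees (H i)) * T₀)
      ≡⟨ cong (λ z → suc (length is) * (z * T₀)) (length-outdegrees (H i)) ⟩
        suc (length is) * (∏ V (suc ∘ degree (H i)) * T₀)
      ≡⟨ *-assoc (suc (length is)) (∏ V (suc ∘ degree (H i))) T₀ ⟨
        suc (length is) * ∏ V (suc ∘ degree (H i)) * T₀
      ≤⟨ *-monoˡ-≤ T₀ (few i i∈) ⟩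
        2 ^ edges (H i) * T₀
      ≡⟨ *-comm (2 ^ edges (H i)) T₀ ⟩
        T₀ * 2 ^ edges (H i)
      ∎)
    ∑bad≡ : ∑ all-bits bad ≡ ∑ is bad-i
    ∑bad≡ = trans
      (∑-swap all-bits is λ χ i → ∑ (outdegrees (H i)) λ o → agree (H i) χ (representative (H i) o))
      (∑-cong is λ i → ∑-swap all-bits (outdegrees (H i)) λ χ o → agree (H i) χ (representative (H i) o))
    ∑bad< : ∑ all-bits bad < T₀
    -- The additional 1 in `suc (length is)` is what makes the union bound strict.
    ∑bad< = *-cancelˡ-< (suc (length is)) _ _ (begin-strict
        suc (length is) * ∑ all-bits bad
      ≡⟨ cong (suc (length is) *_) ∑bad≡ ⟩
        suc (length is) * ∑ is bad-i
      ≡⟨ ∑-*ˡ is (suc (length is)) bad-i ⟨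
        ∑ is (λ i → suc (length is) * bad-i i)
      ≤⟨ ∑-mono∈ is bad-i≤ ⟩
        ∑ is (λ _ → T₀)
      ≡⟨ ∑-const is T₀ ⟩
        length is * T₀
      <⟨ m<n+m (length is * T₀) T₀>0 ⟩
        suc (length is) * T₀
      ∎)

-- Monochromatic cycles in a random orientation

n<2^n : ∀ n → n < 2 ^ n
n<2^n zero    = s≤s z≤n
n<2^n (suc n) = begin-strict
    suc n               ≤⟨ n<2^n n ⟩
    2 ^ n               <⟨ m<m+n (2 ^ n) (m^n>0 2 n) ⟩
    2 ^ n + 2 ^ n       ≡⟨ cong (2 ^ n +_) (+-identityʳ (2 ^ n)) ⟨
    2 ^ suc n           ∎
  where open ≤-Reasoning

-- This is log₂ (d+1) ≤ d/4 + 2 freed of fractions by fourth powers. With q the integer part of d/4,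
-- one has d + 1 ≤ 4(q+1) ≤ 4 · 2^q.
suc^4≤2^ : ∀ d → suc d ^ 4 ≤ 2 ^ (d + 8)
suc^4≤2^ d = begin
    suc d ^ 4                   ≤⟨ ^-monoˡ-≤ 4 sd≤ ⟩
    (4 * 2 ^ q) ^ 4             ≡⟨ ^-distrib-* 4 4 (2 ^ q) ⟩
    2 ^ 8 * (2 ^ q) ^ 4         ≡⟨ cong (2 ^ 8 *_) (^-*-assoc 2 q 4) ⟩
    2 ^ 8 * 2 ^ (q * 4)         ≡⟨ ^-distribˡ-+-* 2 8 (q * 4) ⟨
    2 ^ (8 + q * 4)             ≤⟨ ^-monoʳ-≤ 2 (≤-trans (+-monoʳ-≤ 8 q4≤d) (≤-reflexive (+-comm 8 d))) ⟩
    2 ^ (d + 8)                 ∎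
  where
  open ≤-Reasoning
  q = d / 4
  q4≤d : q * 4 ≤ d
  q4≤d = subst (q * 4 ≤_) (sym (m≡m%n+[m/n]*n d 4)) (m≤n+m (q * 4) (d % 4))
  sd≤ : suc d ≤ 4 * 2 ^ q
  sd≤ = begin
    suc d                       ≡⟨ cong suc (m≡m%n+[m/n]*n d 4) ⟩
    suc (d % 4) + q * 4         ≤⟨ +-monoˡ-≤ (q * 4) (m%n<n d 4) ⟩
    4 + q * 4                   ≡⟨ *-comm (suc q) 4 ⟩
    4 * suc q                   ≤⟨ *-monoʳ-≤ 4 (n<2^n q) ⟩
    4 * 2 ^ q                   ∎

^-cancelʳ-≤ : ∀ k a b → a ^ suc k ≤ b ^ suc k → a ≤ b
^-cancelʳ-≤ k a b le with a ≤? b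
... | yes p = p
... | no ¬p = ⊥-elim (<⇒≱ (^-monoˡ-< (suc k) (≰⇒> ¬p)) le)

∧-true⁻ : ∀ {a b} → (a ∧ b) ≡ true → a ≡ true × b ≡ true
∧-true⁻ {true} {true} _ = refl , refl

module Orientations (G : Graph) (U : Fin (Graph.n G) → Bool)
  (fwd : Fin (Graph.n G) → Fin (Graph.n G) → Bool)
  (fwd-flip : ∀ {u v} → u ≢ v → fwd v u ≡ not (fwd u v)) where

  open Graph G using (n)

  V : List (Fin n)
  V = allFin n

  order : ℕ
  order = ∑ V (𝟙 ∘ U)

  module _ {q : ℕ} where

    -- The monochromatic edges inside `U`, each stored only in its reference direction `fwd`, so
    -- that `edges` counts it once.
    mono : (Fin n → Fin q) → Fin n → Fin n → Bool
    mono φ u v = fwd u v ∧ (adj G u v ∧ ((U u ∧ U v) ∧ does (φ u ≟ φ v)))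

    mono-fwd : ∀ φ u v → mono φ u v ≡ true → fwd u v ≡ true
    mono-fwd φ u v e = proj₁ (∧-true⁻ e)

    mono-adj : ∀ φ u v → mono φ u v ≡ true → adj G u v ≡ true
    mono-adj φ u v e = proj₁ (∧-true⁻ (proj₂ (∧-true⁻ {fwd u v} e)))

    mono-U : ∀ φ u v → mono φ u v ≡ true → U u ≡ true × U v ≡ true
    mono-U φ u v e = ∧-true⁻ (proj₁ (∧-true⁻ (proj₂ (∧-true⁻ {adj G u v} (proj₂ (∧-true⁻ {fwd u v} e))))))

    mono-≡ : ∀ φ u v → mono φ u v ≡ true → φ u ≡ φ v
    mono-≡ φ u v e
      with φ u ≟ φ v
         | proj₂ (∧-true⁻ {U u ∧ U v} (proj₂ (∧-true⁻ {adj G u v} (proj₂ (∧-true⁻ {fwd u v} e)))))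
    ... | yes p | _ = p

    -- Vertices outside `U` have degree 0 here and contribute the factor 1. The constants in the
    -- exponent thus sum to 8 |U| instead of 8n.
    degree^4 : ∀ φ v → suc (degree (mono φ) v) ^ 4 ≤ 2 ^ (degree (mono φ) v + 8 * 𝟙 (U v))
    degree^4 φ v = bound (U v) (degree (mono φ) v) deg≡0
      where
      bound : ∀ b d → (b ≡ false → d ≡ 0) → suc d ^ 4 ≤ 2 ^ (d + 8 * 𝟙 b)
      bound true  d _ = suc^4≤2^ d
      bound false d z rewrite z refl = ≤-refl
      off₁ : U v ≡ false → ∀ u → mono φ v u ≡ false
      off₁ eq u with mono φ v u in e
      ... | false = refl
      ... | true with () ← trans (sym eq) (proj₁ (mono-U φ _ _ e))
      off₂ : U v ≡ false → ∀ u → mono φ u v ≡ false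
      off₂ eq u with mono φ u v in e
      ... | false = refl
      ... | true with () ← trans (sym eq) (proj₂ (mono-U φ _ _ e))
      deg≡0 : U v ≡ false → degree (mono φ) v ≡ 0
      deg≡0 eq = trans (∑-cong V λ u → cong₂ (λ a b → 𝟙 a + 𝟙 b) (off₁ eq u) (off₂ eq u))
        (trans (∑-const V 0) (*-zeroʳ (length V)))

    module _ {s : ℕ} (s>0 : 0 < s) (order>0 : 0 < order) where

      -- With N = |U| and e edges, comparing exponents of fourth powers leaves 4(1 + sN) + 8N + 2e ≤
      -- 4e. Since 1 ≤ N, it suffices that 2e ≥ (4s + 12)N, which is where 2s + 6 comes from.
      few-codes : ∀ φ → (2 * s + 6) * order ≤ edges (mono φ) →
        suc (s ^ order) * ∏ V (suc ∘ degree (mono φ)) ≤ 2 ^ edges (mono φ)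
      few-codes φ le = ^-cancelʳ-≤ 3 _ _ (begin
          (suc (s ^ N) * ∏ V (suc ∘ degree H)) ^ 4
        ≡⟨ ^-distrib-* 4 (suc (s ^ N)) (∏ V (suc ∘ degree H)) ⟩
          suc (s ^ N) ^ 4 * ∏ V (suc ∘ degree H) ^ 4
        ≤⟨ *-mono-≤ (^-monoˡ-≤ 4 s^N<) ∏≤ ⟩
          (2 ^ (1 + s * N)) ^ 4 * 2 ^ (2 * e + 8 * N)
        ≡⟨ cong (_* 2 ^ (2 * e + 8 * N)) (^-*-assoc 2 (1 + s * N) 4) ⟩
          2 ^ ((1 + s * N) * 4) * 2 ^ (2 * e + 8 * N)
        ≡⟨ ^-distribˡ-+-* 2 ((1 + s * N) * 4) (2 * e + 8 * N) ⟨
          2 ^ ((1 + s * N) * 4 + (2 * e + 8 * N))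
        ≤⟨ ^-monoʳ-≤ 2 exponent ⟩
          2 ^ (e * 4)
        ≡⟨ ^-*-assoc 2 e 4 ⟨
          (2 ^ e) ^ 4
        ∎)
        where
        open ≤-Reasoning
        H = mono φ
        N = order
        e = edges H
        s^N< : suc (s ^ N) ≤ 2 ^ (1 + s * N)
        s^N< = begin
            suc (s ^ N)         ≤⟨ +-monoˡ-≤ (s ^ N) (m^n>0 s {{>-nonZero s>0}} N) ⟩
            s ^ N + s ^ N       ≡⟨ cong (s ^ N +_) (+-identityʳ (s ^ N)) ⟨
            2 * s ^ N           ≤⟨ *-monoʳ-≤ 2 (^-monoˡ-≤ N (<⇒≤ (n<2^n s))) ⟩
            2 * (2 ^ s) ^ N     ≡⟨ cong (2 *_) (^-*-assoc 2 s N) ⟩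
            2 ^ (1 + s * N)     ∎
        ∏≤ : ∏ V (suc ∘ degree H) ^ 4 ≤ 2 ^ (2 * e + 8 * N)
        ∏≤ = begin
            ∏ V (suc ∘ degree H) ^ 4                            ≡⟨ ∏-^ʳ V 4 _ ⟨
            ∏ V (λ v → suc (degree H v) ^ 4)                    ≤⟨ ∏-mono V (degree^4 φ) ⟩
            ∏ V (λ v → 2 ^ (degree H v + 8 * 𝟙 (U v)))          ≡⟨ ∏-^ V 2 _ ⟩
            2 ^ ∑ V (λ v → degree H v + 8 * 𝟙 (U v))            ≡⟨ cong (2 ^_) (trans (∑-+ V _ _)
                                                                     (cong₂ _+_ (∑degree H) (∑-*ˡ V 8 _))) ⟩
            2 ^ (2 * e + 8 * N)                                 ∎
        exponent : (1 + s * N) * 4 + (2 * e + 8 * N) ≤ e * 4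
        exponent = begin
            (1 + s * N) * 4 + (2 * e + 8 * N)   ≡⟨ l₁ s N e ⟩
            4 * 1 + (4 * s * N + 8 * N + 2 * e)
          ≤⟨ +-monoˡ-≤ (4 * s * N + 8 * N + 2 * e) (*-monoʳ-≤ 4 order>0) ⟩
            4 * N + (4 * s * N + 8 * N + 2 * e) ≡⟨ l₂ s N e ⟩
            2 * ((2 * s + 6) * N) + 2 * e       ≤⟨ +-monoˡ-≤ (2 * e) (*-monoʳ-≤ 2 le) ⟩
            2 * e + 2 * e                       ≡⟨ l₃ e ⟩
            e * 4                               ∎
          where
          l₁ : ∀ s N e → (1 + s * N) * 4 + (2 * e + 8 * N) ≡ 4 * 1 + (4 * s * N + 8 * N + 2 * e)
          l₁ = solve-∀
          l₂ : ∀ s N e → 4 * N + (4 * s * N + 8 * N + 2 * e) ≡ 2 * ((2 * s + 6) * N) + 2 * e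
          l₂ = solve-∀
          l₃ : ∀ e → 2 * e + 2 * e ≡ e * 4
          l₃ = solve-∀

      module _ (c₀ : Fin q) (Λ : Fin n → List (Fin q)) (|Λ| : ∀ v → length (Λ v) ≡ s)
        (many : ∀ φ → (∀ v → U v ≡ true → φ v ∈ Λ v) → (2 * s + 6) * order ≤ edges (mono φ)) where

        -- The dummy option outside U keeps the number of colourings at s ^ order.
        options : Fin n → List (Fin q)
        options v = if U v then Λ v else c₀ ∷ []

        length-options : length (choices n options) ≡ s ^ order
        length-options = trans (length-choices n options) (trans (∏-cong V size) (∏-^ V s _))
          where
          size : ∀ v → length (options v) ≡ s ^ 𝟙 (U v)
          size v with U v
          ... | true  = trans (|Λ| v) (sym (*-identityʳ s))
          ... | false = refl

        -- Both orders of a pair read the same bit, the one in the reference direction; hence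
        -- exactly one of the two arcs is present on each edge.
        orient : Bits n → Digraph n
        orient χ u v = adj G u v ∧ (if fwd u v then χ u v else not (χ v u))

        distinct : ∀ {u v} → adj G u v ≡ true → u ≢ v
        distinct {u} a refl with () ← trans (sym a) (irrefl G u)

        orient-fwd : ∀ χ {u v} → adj G u v ≡ true → fwd u v ≡ true → orient χ u v ≡ χ u v
        orient-fwd χ a f rewrite a | f = refl

        orient-bwd : ∀ χ {u v} → adj G u v ≡ true → fwd u v ≡ true → orient χ v u ≡ not (χ u v)
        orient-bwd χ {u} {v} a f
          rewrite trans (Graph.sym G v u) a | fwd-flip (distinct a) | f = refl

        orient-isOrientation : ∀ χ → IsOrientation G (orient χ)
        orient-isOrientation χ = (λ u v a → proj₁ (∧-true⁻ a)) , total , antisym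
          where
          total : ∀ u v → adj G u v ≡ true → Arc (orient χ) u v ⊎ Arc (orient χ) v u
          total u v a rewrite trans (Graph.sym G v u) a | a | fwd-flip (distinct a)
            with fwd u v | χ u v | χ v u
          ... | true  | true  | _     = inj₁ refl
          ... | true  | false | _     = inj₂ refl
          ... | false | _     | true  = inj₂ refl
          ... | false | _     | false = inj₁ refl
          antisym : ∀ u v → Arc (orient χ) u v → ¬ Arc (orient χ) v u
          antisym u v p p′ with proj₁ (∧-true⁻ {adj G u v} p)
          ... | a rewrite trans (Graph.sym G v u) a | a | fwd-flip (distinct a)
            with fwd u v | χ u v | χ v u
          antisym u v p () | a | true  | true  | _
          antisym u v () _ | a | true  | false | _
          antisym u v () _ | a | false | _     | true
          antisym u v _ () | a | false | _     | false

        on : ∀ v → U v ≡ true → options v ≡ Λ v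
        on v Uv = cong (λ b → if b then Λ v else c₀ ∷ []) Uv

        restrict : (Fin n → Fin q) → Fin n → Fin q
        restrict φ v = if U v then φ v else c₀

        restrict-∈ : ∀ φ → (∀ v → U v ≡ true → φ v ∈ Λ v) → ∀ v → restrict φ v ∈ options v
        restrict-∈ φ φ∈ v with U v in eq
        ... | true  = φ∈ v eq
        ... | false = here refl

        few : ∀ φ → φ ∈ choices n options →
          suc (length (choices n options)) * ∏ V (suc ∘ degree (mono φ)) ≤ 2 ^ edges (mono φ)
        few φ φ∈ = subst (λ z → suc z * ∏ V (suc ∘ degree (mono φ)) ≤ 2 ^ edges (mono φ))
          (sym length-options)
          (few-codes φ (many φ λ v Uv → subst (φ v ∈_) (on v Uv) (∈-choices⁻ n options φ∈ v)))

        NonRigid : Bits n → (Fin n → Fin q) → Set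
        NonRigid χ φ = ∃ λ χ′ → (∀ v → outdeg (mono φ) χ v ≡ outdeg (mono φ) χ′ v) ×
          ∃ λ u → ∃ λ v → mono φ u v ≡ true × (χ u v xor χ′ u v) ≡ true

        -- All edges of `mono ψ` join vertices of `U` with equal colours, and `ψ` agrees with `φ` on
        -- `U`. The property of having the colour `φ u` therefore spreads along the cycle.
        mono-cycle : ∀ χ (φ ψ : Fin n → Fin q) → (∀ {x} → U x ≡ true → ψ x ≡ φ x) → NonRigid χ ψ →
          Σ (DirectedCycle (orient χ)) λ Γ → ∃ λ c → All (λ v → φ v ≡ c) (DirectedCycle.vertices Γ)
        mono-cycle χ φ ψ ψ≡φ (χ′ , same , u , v , h , d) =
          let Γ , mono-Γ = monochromatic-cycle (mono ψ) (orient χ) {λ x → φ x ≡ φ u} χ χ′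
                (λ {x} {y} h c → trans (orient-fwd χ (mono-adj ψ x y h) (mono-fwd ψ x y h)) c)
                (λ {x} {y} h c → trans (orient-bwd χ (mono-adj ψ x y h) (mono-fwd ψ x y h)) (cong not c))
                (λ {x} {y} h p → trans (sym (φ≡ x y h)) p) (λ {x} {y} h p → trans (φ≡ x y h) p)
                same {u} {v} h d refl
          in Γ , φ u , mono-Γ
          where
          φ≡ : ∀ x y → mono ψ x y ≡ true → φ x ≡ φ y
          φ≡ x y h = trans (sym (ψ≡φ (proj₁ (mono-U ψ x y h))))
            (trans (mono-≡ ψ x y h) (ψ≡φ (proj₂ (mono-U ψ x y h))))

        all-mono-cycle : ∀ χ → (∀ φ → φ ∈ choices n options → NonRigid χ φ) →
          ∀ (φ : Fin n → Fin q) → (∀ v → U v ≡ true → φ v ∈ Λ v) →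
          Σ (DirectedCycle (orient χ)) λ Γ → ∃ λ c → All (λ v → φ v ≡ c) (DirectedCycle.vertices Γ)
        all-mono-cycle χ rigid φ φ∈ =
          from (choices-complete n options (restrict φ) (restrict-∈ φ φ∈))
          where
          from : (∃ λ ψ → ψ ∈ choices n options × (∀ v → ψ v ≡ restrict φ v)) →
            Σ (DirectedCycle (orient χ)) λ Γ → ∃ λ c → All (λ v → φ v ≡ c) (DirectedCycle.vertices Γ)
          from (ψ , ψ∈ , e) = mono-cycle χ φ ψ
            (λ {x} Ux → trans (e x) (cong (λ b → if b then φ x else c₀) Ux)) (rigid ψ ψ∈)

        orientation : Σ (Digraph n) λ D → IsOrientation G D ×
          (∀ (φ : Fin n → Fin q) → (∀ v → U v ≡ true → φ v ∈ Λ v) →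
            Σ (DirectedCycle D) λ Γ → ∃ λ c → All (λ v → φ v ≡ c) (DirectedCycle.vertices Γ))
        orientation = from (non-rigid-bits n (choices n options) mono few)
          where
          from : (∃ λ χ → ∀ φ → φ ∈ choices n options → NonRigid χ φ) → _
          from (χ , rigid) = orient χ , orient-isOrientation χ , all-mono-cycle χ rigid

-- Dense cores

∑-δ : (n : ℕ) (v : Fin n) (f : Fin n → ℕ) → ∑ (allFin n) (λ u → 𝟙 (does (u ≟ v)) * f u) ≡ f v
∑-δ (suc n) zero f = begin
    ∑ (allFin (suc n)) (λ u → 𝟙 (does (u ≟ zero)) * f u)    ≡⟨ ∑-suc n (λ u → 𝟙 (does (u ≟ zero)) * f u) ⟩
    f zero + 0 + ∑ (allFin n) (λ u → 0)
  ≡⟨ cong₂ _+_ (+-identityʳ (f zero)) (∑-zero (allFin n)) ⟩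
    f zero + 0                                              ≡⟨ +-identityʳ (f zero) ⟩
    f zero                                                  ∎
  where open ≡-Reasoning
∑-δ (suc n) (suc v) f = trans (∑-suc n (λ u → 𝟙 (does (u ≟ suc v)) * f u)) (∑-δ n v (f ∘ suc))

module Core (G : Graph) where

  open Graph G using (n)

  V : List (Fin n)
  V = allFin n

  size : (Fin n → Bool) → ℕ
  size U = ∑ V (𝟙 ∘ U)

  degIn : (Fin n → Bool) → Fin n → ℕ
  degIn U v = ∑ V λ u → 𝟙 (U u ∧ adj G v u)

  degSumIn : (Fin n → Bool) → ℕ
  degSumIn U = ∑ V λ v → 𝟙 (U v) * degIn U v

  _∖_ : (Fin n → Bool) → Fin n → Fin n → Bool
  (U ∖ v) u = U u ∧ not (does (u ≟ v))

  size-∖ : ∀ U v → U v ≡ true → size U ≡ suc (size (U ∖ v))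
  size-∖ U v Uv = begin
      size U
    ≡⟨ ∑-cong V point ⟩
      ∑ V (λ u → 𝟙 (does (u ≟ v)) * 1 + 𝟙 ((U ∖ v) u))
    ≡⟨ ∑-+ V _ _ ⟩
      ∑ V (λ u → 𝟙 (does (u ≟ v)) * 1) + size (U ∖ v)
    ≡⟨ cong (_+ size (U ∖ v)) (∑-δ n v (λ _ → 1)) ⟩
      suc (size (U ∖ v))
    ∎
    where
    open ≡-Reasoning
    point : ∀ u → 𝟙 (U u) ≡ 𝟙 (does (u ≟ v)) * 1 + 𝟙 ((U ∖ v) u)
    point u with u ≟ v
    ... | yes refl rewrite Uv = refl
    ... | no _ with U u
    ...   | true  = refl
    ...   | false = refl

  -- An ordered adjacent pair inside `U` avoids `v`, starts at `v` or ends at `v`; these cases are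
  -- counted by `inner`, `row` and `column`.
  degSumIn-∖ : ∀ U v → degSumIn U ≤ degSumIn (U ∖ v) + (degIn U v + degIn U v)
  degSumIn-∖ U v = begin
      degSumIn U
    ≡⟨ ∑-cong V (λ x → ∑-*ˡ V (𝟙 (U x)) _) ⟨
      ∑ V (λ x → ∑ V λ y → 𝟙 (U x) * 𝟙 (U y ∧ adj G x y))
    ≤⟨ ∑-mono V (λ x → ∑-mono V (point x)) ⟩
      ∑ V (λ x → ∑ V λ y → inner x y + (row x y + column x y))
    ≡⟨ ∑-cong V (λ x → trans (∑-+ V _ _) (cong (∑ V (inner x) +_) (∑-+ V _ _))) ⟩
      ∑ V (λ x → ∑ V (inner x) + (∑ V (row x) + ∑ V (column x)))
    ≡⟨ trans (∑-+ V _ _) (cong (∑ V (λ x → ∑ V (inner x)) +_) (∑-+ V _ _)) ⟩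
      ∑ V (λ x → ∑ V (inner x)) + (∑ V (λ x → ∑ V (row x)) + ∑ V (λ x → ∑ V (column x)))
    ≡⟨ cong₂ _+_ (∑-cong V λ x → ∑-*ˡ V (𝟙 ((U ∖ v) x)) _)
         (cong₂ _+_ (trans (∑-cong V λ x → ∑-*ˡ V (𝟙 (does (x ≟ v))) _) (∑-δ n v (λ _ → degIn U v)))
           (∑-cong V λ x → ∑-δ n v (λ _ → 𝟙 (U x ∧ adj G v x)))) ⟩
      degSumIn (U ∖ v) + (degIn U v + degIn U v)
    ∎
    where
    open ≤-Reasoning
    inner row column : Fin n → Fin n → ℕ
    inner x y  = 𝟙 ((U ∖ v) x) * 𝟙 ((U ∖ v) y ∧ adj G x y)
    row x y    = 𝟙 (does (x ≟ v)) * 𝟙 (U y ∧ adj G v y)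
    column x y = 𝟙 (does (y ≟ v)) * 𝟙 (U x ∧ adj G v x)
    𝟙*≤ : ∀ a b → 𝟙 a * b ≤ b
    𝟙*≤ true  b = ≤-reflexive (+-identityʳ b)
    𝟙*≤ false b = z≤n
    flip : ∀ a b c → 𝟙 a * 𝟙 (b ∧ c) ≤ 1 * 𝟙 (a ∧ c)
    flip true  true  c = ≤-refl
    flip true  false c = z≤n
    flip false b     c = z≤n
    same : ∀ a b c → 𝟙 a * 𝟙 (b ∧ c) ≤ 𝟙 (a ∧ true) * 𝟙 ((b ∧ true) ∧ c) + 0
    same true  true  true  = ≤-refl
    same true  true  false = z≤n
    same true  false c     = z≤n
    same false b     c     = z≤n
    point : ∀ x y → 𝟙 (U x) * 𝟙 (U y ∧ adj G x y) ≤ inner x y + (row x y + column x y)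
    point x y with x ≟ v | y ≟ v
    ... | yes refl | w        = ≤-trans (𝟙*≤ (U x) _)
      (≤-trans (≤-trans (≤-reflexive (sym (+-identityʳ _))) (m≤m+n _ (𝟙 (does w) * 𝟙 (U x ∧ adj G x x))))
        (m≤n+m _ (𝟙 (U x ∧ false) * 𝟙 ((U y ∧ not (does w)) ∧ adj G x y))))
    ... | no _     | yes refl = ≤-trans
      (subst (λ a → 𝟙 (U x) * 𝟙 (U y ∧ a) ≤ 1 * 𝟙 (U x ∧ adj G y x)) (Graph.sym G y x)
        (flip (U x) (U y) (adj G y x)))
      (m≤n+m _ (𝟙 (U x ∧ true) * 𝟙 ((U y ∧ false) ∧ adj G x y)))
    ... | no _     | no _     = same (U x) (U y) (adj G x y)

  -- Vertices of degree below d are deleted one at a time. Each deletion lowers the degree sum by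
  -- less than 2d, which preserves the invariant that the sum is at least 2d times the size.
  dense-core : ∀ d → 0 < d → ∀ k U → size U ≡ k → 0 < k → 2 * d * k ≤ degSumIn U →
    ∃ λ U′ → 0 < size U′ × (∀ v → U′ v ≡ true → d ≤ degIn U′ v)
  dense-core d d>0 (suc k) U |U| _ dense
    with Fin.any? (λ v → (U v Bool.≟ true) ×-dec (degIn U v <? d))
  ... | no none = U , subst (0 <_) (sym |U|) (s≤s z≤n) , λ v Uv → ≮⇒≥ λ lt → none (v , Uv , lt)
  ... | yes (v , Uv , low) = dense-core d d>0 k (U ∖ v) |U∖v| k>0 (<⇒≤ dense′)
    where
    open ≤-Reasoning
    |U∖v| : size (U ∖ v) ≡ k
    |U∖v| = suc-injective (trans (sym (size-∖ U v Uv)) |U|)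
    dense′ : 2 * d * k < degSumIn (U ∖ v)
    dense′ = +-cancelʳ-< (2 * d) _ _ (begin-strict
        2 * d * k + 2 * d                               ≡⟨ trans (*-suc (2 * d) k) (+-comm (2 * d) _) ⟨
        2 * d * suc k                                   ≤⟨ dense ⟩
        degSumIn U                                      ≤⟨ degSumIn-∖ U v ⟩
        degSumIn (U ∖ v) + (degIn U v + degIn U v)      <⟨ +-monoʳ-< (degSumIn (U ∖ v)) (+-mono-< low low) ⟩
        degSumIn (U ∖ v) + (d + d)
      ≡⟨ cong (λ z → degSumIn (U ∖ v) + (d + z)) (+-identityʳ d) ⟨
        degSumIn (U ∖ v) + 2 * d                        ∎)
    -- The invariant became strict, so the remaining degree sum is positive and the remaining set is
    -- nonempty: the deletion stops before everything is removed.
    k>0 : 0 < k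
    k>0 = subst (0 <_) |U∖v| (let w , _ , p = ∑-pos⇒∃ V _ (≤-trans (s≤s z≤n) dense′)
            in ≤-trans (pos ((U ∖ v) w) _ p) (∑-∈ (𝟙 ∘ (U ∖ v)) (∈-allFin w)))
      where
      pos : ∀ b x → 0 < 𝟙 b * x → 0 < 𝟙 b
      pos true _ _ = s≤s z≤n

  min-degree-core : ∀ d → 0 < d → AdAtLeast G (2 * d) →
    ∃ λ U → 0 < size U × (∀ v → U v ≡ true → d ≤ degIn U v)
  min-degree-core d d>0 (n>0 , dense) = dense-core d d>0 n (λ _ → true)
    (trans (∑-length V) (length-allFin n)) n>0
    (≤-trans dense (≤-reflexive (∑-cong V λ v → sym (+-identityʳ (deg G v)))))

-- Random lists

all-∈ : {A : Set} (p : A → Bool) {xs : List A} {x : A} → all p xs ≡ true → x ∈ xs → p x ≡ true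
all-∈ p {y ∷ ys} e (here refl) = proj₁ (∧-true⁻ e)
all-∈ p {y ∷ ys} e (there x∈)  = all-∈ p (proj₂ (∧-true⁻ {p y} e)) x∈

𝟙-not : ∀ b → 𝟙 b + 𝟙 (not b) ≡ 1
𝟙-not true  = refl
𝟙-not false = refl

𝟙-≤ : ∀ {m} b → (b ≡ true → 1 ≤ m) → 𝟙 b ≤ m
𝟙-≤ true  f = f refl
𝟙-≤ false f = z≤n

-- A random list falls into a fixed half of the palette with probability at least 1/P, a vertex
-- enters B with probability 1/Q, and a colour is frequent at a vertex when more than `t` of its
-- neighbours in B carry it. `R` is the most neighbours that q colours can cover if each occurs at
-- most `t` times.
module Lists (G : Graph) (U : Fin (Graph.n G) → Bool) (h s P Q t : ℕ)
  (s≤h : s ≤ h) (P>0 : 0 < P) (Q>0 : 0 < Q) (halve : (2 * h) C s ≤ P * (h C s)) where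

  open Graph G using (n)

  q R : ℕ
  q = 2 * h
  R = q * t

  Colour : Set
  Colour = Fin q

  V : List (Fin n)
  V = allFin n

  order : ℕ
  order = ∑ V (𝟙 ∘ U)

  nb : Fin n → Fin n → Bool
  nb v u = U u ∧ adj G v u

  palette : List (List Colour)
  palette = combs s (allFin q)

  c : ℕ
  c = length palette

  c≡ : c ≡ q C s
  c≡ = trans (length-combs s (allFin q)) (cong (_C s) (length-allFin q))

  c>0 : 0 < c
  c>0 = subst (0 <_) (sym c≡) (C-pos (≤-trans s≤h (m≤m+n h (h + 0))))

  palette-hit : (p : Colour → Bool) → h ≤ ∑ (allFin q) (𝟙 ∘ p) → c ≤ P * ∑ palette (𝟙 ∘ all p)
  palette-hit p h≤ = begin
      c                                       ≡⟨ c≡ ⟩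
      q C s                                   ≤⟨ halve ⟩
      P * (h C s)                             ≤⟨ *-monoʳ-≤ P (C-monoˡ s h≤) ⟩
      P * (∑ (allFin q) (𝟙 ∘ p) C s)          ≡⟨ cong (P *_) (∑-combs p s (allFin q)) ⟨
      P * ∑ palette (𝟙 ∘ all p)               ∎
    where open ≤-Reasoning

  -- A vertex in state just S belongs to B and has list S; the padding makes |B| about |U| / Q.
  State : Set
  State = Maybe (List Colour)

  states : List State
  states = map just palette ++ replicate (pred Q * c) nothing

  length-states : length states ≡ Q * c
  length-states = begin
      length states                                         ≡⟨ length-++ (map just palette) ⟩
      length (map just palette) + length (replicate (pred Q * c) (nothing {A = List Colour}))
    ≡⟨ cong₂ _+_ (length-map just palette) (length-replicate (pred Q * c)) ⟩
      suc (pred Q) * c                                      ≡⟨ cong (_* c) (suc-pred Q {{>-nonZero Q>0}}) ⟩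
      Q * c                                                 ∎
    where open ≡-Reasoning

  ∑-states : (f : State → ℕ) → f nothing ≡ 0 → ∑ states f ≡ ∑ palette (f ∘ just)
  ∑-states f f0 = begin
      ∑ states f                                                ≡⟨ ∑-++ (map just palette) _ f ⟩
      ∑ (map just palette) f + ∑ (replicate (pred Q * c) nothing) f
    ≡⟨ cong₂ _+_ (∑-map just palette f) (none (pred Q * c)) ⟩
      ∑ palette (f ∘ just) + 0                                  ≡⟨ +-identityʳ _ ⟩
      ∑ palette (f ∘ just)                                      ∎
    where
    open ≡-Reasoning
    none : ∀ k → ∑ (replicate k nothing) f ≡ 0
    none zero    = refl
    none (suc k) = cong₂ _+_ f0 (none k)

  just-∈-states : ∀ {S} → just S ∈ states → S ∈ palette
  just-∈-states {S} S∈ with ∈-++⁻ (map just palette) S∈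
  ... | inj₁ S∈′ with _ , S′∈ , e ← ∈-map⁻ just S∈′ = subst (_∈ palette) (sym (just-injective e)) S′∈
  ... | inj₂ S∈′ = ⊥-elim (none (pred Q * c) S∈′)
    where
    none : ∀ k → just S ∈ replicate k nothing → ⊥
    none (suc k) (there p) = none k p

  inside : (Colour → Bool) → State → Bool
  inside p = maybe′ (all p) false

  hits : (Fin n → State) → Fin n → (Colour → Bool) → ℕ
  hits σ v p = ∑ V λ u → 𝟙 (nb v u ∧ inside p (σ u))

  predicates : List (Colour → Bool)
  predicates = choices q λ _ → true ∷ false ∷ []

  large : (Colour → Bool) → Bool
  large p = h ≤ᵇ ∑ (allFin q) (𝟙 ∘ p)

  -- Counts the large colour sets that contain the lists of at most `R` neighbours in B. It vanishes
  -- when `v` has the property required of good vertices.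
  defects : (Fin n → State) → Fin n → ℕ
  defects σ v = ∑ predicates λ p → 𝟙 (large p ∧ (hits σ v p ≤ᵇ R))

  -- One quantity dominates both the part of B inside `U` and the number of vertices of `U` with a
  -- defect, so one averaging argument controls both.
  cost : (Fin n → State) → ℕ
  cost σ = ∑ V λ v → 𝟙 (U v) * (𝟙 (is-just (σ v)) + defects σ v)

  samples : List (Fin n → State)
  samples = choices n λ _ → states

  W : ℕ
  W = length states ^ n

  W>0 : 0 < W
  W>0 = m^n>0 (length states) {{>-nonZero (subst (0 <_) (sym length-states)
          (*-mono-≤ Q>0 c>0))}} n

  ∑-is-just : ∀ v → Q * ∑ samples (λ σ → 𝟙 (is-just (σ v))) ≤ W
  ∑-is-just = ∑-choices-marginal n states Q (𝟙 ∘ is-just) (≤-reflexive (begin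
      Q * ∑ states (𝟙 ∘ is-just)      ≡⟨ cong (Q *_) (∑-states (𝟙 ∘ is-just) refl) ⟩
      Q * ∑ palette (λ _ → 1)         ≡⟨ cong (Q *_) (∑-length palette) ⟩
      Q * c                           ≡⟨ length-states ⟨
      length states                   ∎))
    where open ≡-Reasoning

  module _ (d : ℕ) (2QP2R≤d : 2 * (Q * P) * (2 * R) ≤ d) (Q2^q≤2^R : Q * 2 ^ q ≤ 2 ^ R)
           (min-degree : ∀ v → U v ≡ true → d ≤ ∑ V (𝟙 ∘ nb v)) where

    -- A neighbour lies in B with its list inside `p` with probability at least 1/(QP). The tail
    -- bound with κ = QP and J = 2R gives failure probability at most 2^(R-2R) = 2^-R.
    ∑-few-hits : ∀ v → U v ≡ true → ∀ p →
      ∑ samples (λ σ → 𝟙 (large p ∧ (hits σ v p ≤ᵇ R))) * 2 ^ (2 * R) ≤ 2 ^ R * W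
    ∑-few-hits v Uv p with large p in eq
    ... | false rewrite ∑-zero samples = z≤n
    ... | true = LowerTail.lower-tail n states (nb v) (λ _ → inside p) (Q * P) R (2 * R)
      (*-mono-≤ Q>0 P>0) (λ _ _ → likely) (≤-trans 2QP2R≤d (min-degree v Uv))
      where
      open ≤-Reasoning
      likely : length states ≤ Q * P * ∑ states (𝟙 ∘ inside p)
      likely = begin
        length states                               ≡⟨ length-states ⟩
        Q * c                                       ≤⟨ *-monoʳ-≤ Q (palette-hit p (≤ᵇ-true h _ eq)) ⟩
        Q * (P * ∑ palette (𝟙 ∘ all p))             ≡⟨ *-assoc Q P _ ⟨
        Q * P * ∑ palette (𝟙 ∘ all p)               ≡⟨ cong (Q * P *_) (∑-states (𝟙 ∘ inside p) refl) ⟨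
        Q * P * ∑ states (𝟙 ∘ inside p)             ∎

    -- Union bound over the 2^q colour sets: 2^q · 2^-R is at most 1/Q.
    ∑-defects : ∀ v → U v ≡ true → Q * ∑ samples (λ σ → defects σ v) ≤ W
    ∑-defects v Uv = *-cancelʳ-≤ _ _ (2 ^ (2 * R)) {{m^n≢0 2 (2 * R)}} (begin
        Q * ∑ samples (λ σ → defects σ v) * 2 ^ (2 * R)
      ≡⟨ cong (λ z → Q * z * 2 ^ (2 * R))
           (∑-swap samples predicates λ σ p → 𝟙 (large p ∧ (hits σ v p ≤ᵇ R))) ⟩
        Q * ∑ predicates few * 2 ^ (2 * R)
      ≡⟨ trans (*-assoc Q _ _) (cong (Q *_) (sym (∑-*ʳ predicates (2 ^ (2 * R)) few))) ⟩
        Q * ∑ predicates (λ p → few p * 2 ^ (2 * R))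
      ≤⟨ *-monoʳ-≤ Q (∑-mono predicates (∑-few-hits v Uv)) ⟩
        Q * ∑ predicates (λ _ → 2 ^ R * W)
      ≡⟨ cong (Q *_) (trans (∑-const predicates _) (cong (_* (2 ^ R * W)) (length-choices-const q _))) ⟩
        Q * (2 ^ q * (2 ^ R * W))
      ≡⟨ lem Q (2 ^ q) (2 ^ R) W ⟩
        Q * 2 ^ q * 2 ^ R * W
      ≤⟨ *-monoˡ-≤ W (*-monoˡ-≤ (2 ^ R) Q2^q≤2^R) ⟩
        2 ^ R * 2 ^ R * W
      ≡⟨ cong (_* W) (trans (sym (^-distribˡ-+-* 2 R R)) (cong (λ z → 2 ^ (R + z)) (sym (+-identityʳ R)))) ⟩
        2 ^ (2 * R) * W
      ≡⟨ *-comm (2 ^ (2 * R)) W ⟩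
        W * 2 ^ (2 * R)
      ∎)
      where
      open ≤-Reasoning
      few : (Colour → Bool) → ℕ
      few p = ∑ samples λ σ → 𝟙 (large p ∧ (hits σ v p ≤ᵇ R))
      lem : ∀ a b c d → a * (b * (c * d)) ≡ a * b * c * d
      lem = solve-∀

    ∑-cost : Q * ∑ samples cost ≤ 2 * order * W
    ∑-cost = begin
        Q * ∑ samples cost
      ≡⟨ cong (Q *_) (∑-swap samples V λ σ v → 𝟙 (U v) * (𝟙 (is-just (σ v)) + defects σ v)) ⟩
        Q * ∑ V (λ v → ∑ samples λ σ → 𝟙 (U v) * (𝟙 (is-just (σ v)) + defects σ v))
      ≡⟨ ∑-*ˡ V Q _ ⟨
        ∑ V (λ v → Q * ∑ samples λ σ → 𝟙 (U v) * (𝟙 (is-just (σ v)) + defects σ v))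
      ≤⟨ ∑-mono V point ⟩
        ∑ V (λ v → 𝟙 (U v) * (2 * W))
      ≡⟨ ∑-*ʳ V (2 * W) _ ⟩
        order * (2 * W)
      ≡⟨ lem order W ⟩
        2 * order * W
      ∎
      where
      open ≤-Reasoning
      lem : ∀ a b → a * (2 * b) ≡ 2 * a * b
      lem = solve-∀
      point : ∀ v → Q * ∑ samples (λ σ → 𝟙 (U v) * (𝟙 (is-just (σ v)) + defects σ v)) ≤ 𝟙 (U v) * (2 * W)
      point v with U v in Uv
      ... | false = ≤-reflexive (trans (cong (Q *_) (∑-zero samples)) (*-zeroʳ Q))
      ... | true  = begin
          Q * ∑ samples (λ σ → 1 * (𝟙 (is-just (σ v)) + defects σ v))
        ≡⟨ cong (Q *_) (trans (∑-*ˡ samples 1 _) (trans (*-identityˡ _) (∑-+ samples _ _))) ⟩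
          Q * (∑ samples (λ σ → 𝟙 (is-just (σ v))) + ∑ samples (λ σ → defects σ v))
        ≡⟨ *-distribˡ-+ Q (∑ samples (λ σ → 𝟙 (is-just (σ v)))) (∑ samples (λ σ → defects σ v)) ⟩
          Q * ∑ samples (λ σ → 𝟙 (is-just (σ v))) + Q * ∑ samples (λ σ → defects σ v)
        ≤⟨ +-mono-≤ (∑-is-just v) (∑-defects v Uv) ⟩
          W + W
        ≡⟨ lem₂ W ⟩
          1 * (2 * W)
        ∎
        where
        lem₂ : ∀ w → w + w ≡ 1 * (2 * w)
        lem₂ = solve-∀

    cheap-sample : ∃ λ σ → σ ∈ samples × Q * cost σ ≤ 2 * order
    cheap-sample =
      -- Comparing with `suc (2 * order)` turns the weak bound on the mean into the strict one
      -- required for extracting a sample.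
      let σ , σ∈ , lt = ∑-<⇒∃ samples (λ σ → Q * cost σ) (λ _ → suc (2 * order)) (begin-strict
            ∑ samples (λ σ → Q * cost σ)          ≡⟨ ∑-*ˡ samples Q cost ⟩
            Q * ∑ samples cost                    ≤⟨ ∑-cost ⟩
            2 * order * W                         <⟨ m<n+m (2 * order * W) W>0 ⟩
            suc (2 * order) * W                   ≡⟨ *-comm (suc (2 * order)) W ⟩
            W * suc (2 * order)                   ≡⟨ cong (_* suc (2 * order)) (length-choices-const n states) ⟨
            length samples * suc (2 * order)      ≡⟨ ∑-const samples (suc (2 * order)) ⟨
            ∑ samples (λ _ → suc (2 * order))     ∎)
      in σ , σ∈ , s≤s⁻¹ lt
      where open ≤-Reasoning

  -- Trapping lists outside a fixed B

  module Extend (σ : Fin n → State) (σ∈ : ∀ v → σ v ∈ states) (c₀ : Colour) where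

    B : Fin n → Bool
    B = is-just ∘ σ

    good : Fin n → Bool
    good v = U v ∧ (not (B v) ∧ (defects σ v ≡ᵇ 0))

    #good : ℕ
    #good = ∑ V (𝟙 ∘ good)

    order≤ : order ≤ #good + cost σ
    order≤ = ≤-trans (∑-mono V λ v → bool (U v) (B v) (defects σ v)) (≤-reflexive (∑-+ V _ _))
      where
      bool : ∀ a b d → 𝟙 a ≤ 𝟙 (a ∧ (not b ∧ (d ≡ᵇ 0))) + 𝟙 a * (𝟙 b + d)
      bool false b     d       = z≤n
      bool true  true  d       = s≤s z≤n
      bool true  false zero    = ≤-refl
      bool true  false (suc d) = s≤s z≤n

    -- Only vertices of B inside `U` have a genuine choice; the single dummy colour elsewhere keeps
    -- the number of colourings at most s^(cost).
    B-options : Fin n → List Colour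
    B-options u = maybe′ (λ S → if U u then S else c₀ ∷ []) (c₀ ∷ []) (σ u)

    B-colourings : List (Fin n → Colour)
    B-colourings = choices n B-options

    length-B-colourings : length B-colourings ≤ 2 ^ (s * cost σ)
    length-B-colourings = begin
        length B-colourings                           ≡⟨ length-choices n B-options ⟩
        ∏ V (λ u → length (B-options u))              ≤⟨ ∏-mono V (λ u → point (U u) (σ u) (defects σ u) (σ∈ u)) ⟩
        ∏ V (λ u → (2 ^ s) ^ (𝟙 (U u) * (𝟙 (B u) + defects σ u))) ≡⟨ ∏-^ V (2 ^ s) _ ⟩
        (2 ^ s) ^ cost σ                              ≡⟨ ^-*-assoc 2 s (cost σ) ⟩
        2 ^ (s * cost σ)                              ∎
      where
      open ≤-Reasoning
      point : ∀ b (st : State) d → st ∈ states →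
        length (maybe′ (λ S → if b then S else c₀ ∷ []) (c₀ ∷ []) st) ≤ (2 ^ s) ^ (𝟙 b * (𝟙 (is-just st) + d))
      point b     nothing  d _   = m^n>0 (2 ^ s) {{m^n≢0 2 s}} (𝟙 b * (0 + d))
      point false (just S) d _   = s≤s z≤n
      point true  (just S) d st∈ = begin
        length S                        ≡⟨ combs-length s {allFin q} (just-∈-states st∈) ⟩
        s                               ≤⟨ <⇒≤ (n<2^n s) ⟩
        2 ^ s                           ≡⟨ *-identityʳ (2 ^ s) ⟨
        (2 ^ s) ^ 1                     ≤⟨ ^-monoʳ-≤ (2 ^ s) {{m^n≢0 2 s}} {1} {1 * (1 + d)} (s≤s z≤n) ⟩
        (2 ^ s) ^ (1 * (1 + d))         ∎

    count : (Fin n → Colour) → Fin n → Colour → ℕ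
    count φ a x = ∑ V λ u → 𝟙 ((nb a u ∧ B u) ∧ does (φ u ≟ x))

    frequent : (Fin n → Colour) → Fin n → Colour → Bool
    frequent φ a x = not (count φ a x ≤ᵇ t)

    -- A neighbour in B whose list lies inside `p` receives a colour of `p`. Sorting these
    -- neighbours by colour gives at most `t` for each of at most q colours.
    hits≤ : ∀ φ → φ ∈ B-colourings → ∀ a p → (∀ x → p x ≡ true → count φ a x ≤ t) → hits σ a p ≤ R
    hits≤ φ φ∈ a p rare = begin
        hits σ a p
      ≤⟨ ∑-mono V point ⟩
        ∑ V (λ u → ∑ (allFin q) λ x → 𝟙 (p x) * 𝟙 ((nb a u ∧ B u) ∧ does (φ u ≟ x)))
      ≡⟨ ∑-swap V (allFin q) (λ u x → 𝟙 (p x) * 𝟙 ((nb a u ∧ B u) ∧ does (φ u ≟ x))) ⟩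
        ∑ (allFin q) (λ x → ∑ V λ u → 𝟙 (p x) * 𝟙 ((nb a u ∧ B u) ∧ does (φ u ≟ x)))
      ≡⟨ ∑-cong (allFin q) (λ x → ∑-*ˡ V (𝟙 (p x)) _) ⟩
        ∑ (allFin q) (λ x → 𝟙 (p x) * count φ a x)
      ≤⟨ ∑-mono (allFin q) (λ x → bounded (p x) (rare x)) ⟩
        ∑ (allFin q) (λ x → t)
      ≡⟨ trans (∑-const (allFin q) t) (cong (_* t) (length-allFin q)) ⟩
        R
      ∎
      where
      open ≤-Reasoning
      bounded : ∀ b {x} → (b ≡ true → x ≤ t) → 𝟙 b * x ≤ t
      bounded false     f = z≤n
      bounded true  {x} f = ≤-trans (≤-reflexive (+-identityʳ x)) (f refl)
      same : ∀ y → 𝟙 (does (y ≟ y)) ≡ 1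
      same y with y ≟ y
      ... | yes _ = refl
      ... | no ¬e = ⊥-elim (¬e refl)
      here-one : ∀ b (st : State) a y → y ∈ maybe′ (λ S → if b then S else c₀ ∷ []) (c₀ ∷ []) st →
        ((b ∧ a) ∧ inside p st) ≡ true → 1 ≤ 𝟙 (p y) * 𝟙 (((b ∧ a) ∧ is-just st) ∧ does (y ≟ y))
      here-one true (just S) true y y∈ e rewrite all-∈ p e y∈ | same y = ≤-refl
      here-one true nothing  true y y∈ ()
      point : ∀ u → 𝟙 (nb a u ∧ inside p (σ u)) ≤
        ∑ (allFin q) (λ x → 𝟙 (p x) * 𝟙 ((nb a u ∧ B u) ∧ does (φ u ≟ x)))
      point u = 𝟙-≤ (nb a u ∧ inside p (σ u)) λ e → ≤-trans
        (here-one (U u) (σ u) (adj G a u) (φ u) (∈-choices⁻ n B-options φ∈ u) e)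
        (∑-∈ (λ x → 𝟙 (p x) * 𝟙 ((nb a u ∧ B u) ∧ does (φ u ≟ x))) (∈-allFin (φ u)))

    -- Otherwise the colours that are not frequent fill at least half of the palette. By `hits≤`
    -- this set contains the lists of at most `R` neighbours, so it is a defect at `a`.
    many-frequent : ∀ φ → φ ∈ B-colourings → ∀ a → good a ≡ true →
      h ≤ ∑ (allFin q) (𝟙 ∘ frequent φ a)
    many-frequent φ φ∈ a ga = ≮⇒≥ λ few → contra few
      (choices-complete q (λ _ → true ∷ false ∷ []) (not ∘ frequent φ a)
        (λ x → any-bool (not (frequent φ a x))))
      where
      open ≤-Reasoning
      any-bool : ∀ b → b ∈ true ∷ false ∷ []
      any-bool true  = here refl
      any-bool false = there (here refl)
      no-defects : defects σ a ≡ 0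
      no-defects = ≡ᵇ⇒≡ (defects σ a) 0
        (subst T (sym (proj₂ (∧-true⁻ {not (B a)} (proj₂ (∧-true⁻ {U a} ga))))) _)
      contra : ∑ (allFin q) (𝟙 ∘ frequent φ a) < h →
        (∃ λ p → p ∈ predicates × (∀ x → p x ≡ not (frequent φ a x))) → ⊥
      contra few (p , p∈ , e) = absurd (large p) (hits σ a p ≤ᵇ R) large-p few-hits
        (n≤0⇒n≡0 (subst (𝟙 (large p ∧ (hits σ a p ≤ᵇ R)) ≤_) no-defects
          (∑-∈ (λ p → 𝟙 (large p ∧ (hits σ a p ≤ᵇ R))) p∈)))
        where
        absurd : ∀ a b → T a → T b → 𝟙 (a ∧ b) ≡ 0 → ⊥
        absurd true true _ _ ()
        rare : ∀ b → not (not b) ≡ true → T b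
        rare true _ = _
        few-hits : T (hits σ a p ≤ᵇ R)
        few-hits = ≤⇒≤ᵇ (hits≤ φ φ∈ a p λ x px →
          ≤ᵇ⇒≤ _ t (rare (count φ a x ≤ᵇ t) (trans (sym (e x)) px)))
        large-p : T (large p)
        large-p = ≤⇒≤ᵇ (+-cancelˡ-≤ (∑ (allFin q) (𝟙 ∘ frequent φ a)) _ _ (begin
            ∑ (allFin q) (𝟙 ∘ frequent φ a) + h
          ≤⟨ +-monoˡ-≤ h (<⇒≤ few) ⟩
            h + h
          ≡⟨ cong (h +_) (+-identityʳ h) ⟨
            q
          ≡⟨ trans (∑-length (allFin q)) (length-allFin q) ⟨
            ∑ (allFin q) (λ _ → 1)
          ≡⟨ ∑-cong (allFin q) (λ x → trans (cong (λ b → 𝟙 (frequent φ a x) + 𝟙 b) (e x))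
               (𝟙-not (frequent φ a x))) ⟨
            ∑ (allFin q) (λ x → 𝟙 (frequent φ a x) + 𝟙 (p x))
          ≡⟨ ∑-+ (allFin q) _ _ ⟩
            ∑ (allFin q) (𝟙 ∘ frequent φ a) + ∑ (allFin q) (𝟙 ∘ p)
          ∎))

    -- At such a vertex every choice from its list creates more than `t` monochromatic edges towards
    -- B.
    trapped : (Fin n → Colour) → (Fin n → List Colour) → ℕ
    trapped φ ℓ = ∑ V λ a → 𝟙 (good a ∧ all (frequent φ a) (ℓ a))

    assignments : List (Fin n → List Colour)
    assignments = choices n λ _ → palette

    module _ (k : ℕ) (k>0 : 0 < k) (s*cost≤ : s * cost σ ≤ 4 * k) (2P8k≤ : 2 * P * (8 * k) ≤ #good) where

      -- By `many-frequent` a good vertex is trapped with probability at least 1/P. The tail bound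
      -- with J = 8k makes at most k trapped vertices an event of probability at most 2^(-7k).
      few-trapped : ∀ φ → φ ∈ B-colourings →
        ∑ assignments (λ ℓ → 𝟙 (trapped φ ℓ ≤ᵇ k)) * 2 ^ (8 * k) ≤ 2 ^ k * c ^ n
      few-trapped φ φ∈ = LowerTail.lower-tail n palette good (λ a → all (frequent φ a)) P k (8 * k) P>0
        (λ a ga → palette-hit (frequent φ a) (many-frequent φ φ∈ a ga)) 2P8k≤

      -- Union bound over the colourings of B, of which there are at most 2^(4k): the total 2^(4k) ·
      -- 2^k stays below 2^(8k). The same lists `ℓ` therefore serve every colouring of B.
      trapping-lists : ∃ λ ℓ → ℓ ∈ assignments × (∀ φ → φ ∈ B-colourings → k < trapped φ ℓ)
      trapping-lists =
        let ℓ , ℓ∈ , lt = ∑-<⇒∃ assignments bad (λ _ → 1) (subst (∑ assignments bad <_)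
              (sym (trans (∑-length assignments) (length-choices-const n palette))) ∑bad<)
        in ℓ , ℓ∈ , λ φ φ∈ → ok (trapped φ ℓ ≤ᵇ k) refl
             (≤-trans (∑-∈ (λ φ → 𝟙 (trapped φ ℓ ≤ᵇ k)) φ∈) (s≤s⁻¹ lt))
        where
        open ≤-Reasoning
        bad : (Fin n → List Colour) → ℕ
        bad ℓ = ∑ B-colourings λ φ → 𝟙 (trapped φ ℓ ≤ᵇ k)
        ok : ∀ {x} b → (x ≤ᵇ k) ≡ b → 𝟙 b ≤ 0 → k < x
        ok {x} false e _ = ≤ᵇ-false x k e
        c^n>0 : 0 < c ^ n
        c^n>0 = m^n>0 c {{>-nonZero c>0}} n
        ∑bad< : ∑ assignments bad < c ^ n
        ∑bad< = *-cancelʳ-< (2 ^ (8 * k)) _ _ (begin-strict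
            ∑ assignments bad * 2 ^ (8 * k)
          ≡⟨ cong (_* 2 ^ (8 * k)) (∑-swap assignments B-colourings λ ℓ φ → 𝟙 (trapped φ ℓ ≤ᵇ k)) ⟩
            ∑ B-colourings (λ φ → ∑ assignments λ ℓ → 𝟙 (trapped φ ℓ ≤ᵇ k)) * 2 ^ (8 * k)
          ≡⟨ ∑-*ʳ B-colourings (2 ^ (8 * k)) _ ⟨
            ∑ B-colourings (λ φ → ∑ assignments (λ ℓ → 𝟙 (trapped φ ℓ ≤ᵇ k)) * 2 ^ (8 * k))
          ≤⟨ ∑-mono∈ B-colourings few-trapped ⟩
            ∑ B-colourings (λ _ → 2 ^ k * c ^ n)
          ≡⟨ ∑-const B-colourings _ ⟩
            length B-colourings * (2 ^ k * c ^ n)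
          ≤⟨ *-monoˡ-≤ (2 ^ k * c ^ n) (≤-trans length-B-colourings (^-monoʳ-≤ 2 s*cost≤)) ⟩
            2 ^ (4 * k) * (2 ^ k * c ^ n)
          ≡⟨ *-assoc (2 ^ (4 * k)) (2 ^ k) (c ^ n) ⟨
            2 ^ (4 * k) * 2 ^ k * c ^ n
          ≡⟨ cong (_* c ^ n) (^-distribˡ-+-* 2 (4 * k) k) ⟨
            2 ^ (4 * k + k) * c ^ n
          <⟨ *-monoˡ-< (c ^ n) {{>-nonZero c^n>0}} (^-monoʳ-< 2 (s≤s (s≤s z≤n)) 5k<8k) ⟩
            2 ^ (8 * k) * c ^ n
          ≡⟨ *-comm (2 ^ (8 * k)) (c ^ n) ⟩
            c ^ n * 2 ^ (8 * k)
          ∎)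
          where
          5k<8k : 4 * k + k < 8 * k
          5k<8k = subst (4 * k + k <_) (l k) (m<m+n (4 * k + k) (≤-trans k>0 (m≤m+n k (2 * k))))
            where
            l : ∀ k → (4 * k + k) + (k + 2 * k) ≡ 8 * k
            l = solve-∀

-- From lists to colourings

does-true : ∀ {q} (x y : Fin q) → does (x ≟ y) ≡ true → x ≡ y
does-true x y e with x ≟ y
... | yes p = p

does-refl : ∀ {q} (x : Fin q) → does (x ≟ x) ≡ true
does-refl x with x ≟ x
... | yes _ = refl
... | no ¬e = ⊥-elim (¬e refl)

<ᵇ-flip : ∀ {m n} → m ≢ n → (n <ᵇ m) ≡ not (m <ᵇ n)
<ᵇ-flip {zero}  {zero}  ne = ⊥-elim (ne refl)
<ᵇ-flip {zero}  {suc n} ne = refl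
<ᵇ-flip {suc m} {zero}  ne = refl
<ᵇ-flip {suc m} {suc n} ne = <ᵇ-flip {m} {n} (ne ∘ cong suc)

module Towards {n : ℕ} (B : Fin n → Bool) where

  -- A reference direction with every edge between B and its complement pointing into B; the
  -- remaining pairs are ordered by index. The edges found at a trapped vertex then all lie in its
  -- own row of `mono`.
  towards : Fin n → Fin n → Bool
  towards u v = if B u then B v ∧ (toℕ u <ᵇ toℕ v) else B v ∨ (toℕ u <ᵇ toℕ v)

  towards-flip : ∀ {u v} → u ≢ v → towards v u ≡ not (towards u v)
  towards-flip {u} {v} ne with B u | B v
  ... | true  | true  = <ᵇ-flip (ne ∘ toℕ-injective)
  ... | true  | false = refl
  ... | false | true  = refl
  ... | false | false = <ᵇ-flip (ne ∘ toℕ-injective)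

  towards-true : ∀ {u v} → B u ≡ false → B v ≡ true → towards u v ≡ true
  towards-true e e′ rewrite e | e′ = refl

module Colouring (G : Graph) (U : Fin (Graph.n G) → Bool) (h s P Q t : ℕ)
  (s≤h : s ≤ h) (P>0 : 0 < P) (Q>0 : 0 < Q) (halve : (2 * h) C s ≤ P * (h C s))
  (σ : Fin (Graph.n G) → Lists.State G U h s P Q t s≤h P>0 Q>0 halve)
  (σ∈ : ∀ v → σ v ∈ Lists.states G U h s P Q t s≤h P>0 Q>0 halve)
  (c₀ : Lists.Colour G U h s P Q t s≤h P>0 Q>0 halve) where

  open Lists G U h s P Q t s≤h P>0 Q>0 halve
  open Extend σ σ∈ c₀
  open Graph G using (n)
  open Towards B
  open Orientations G U towards towards-flip using (mono; orientation)

  module _ (ℓ : Fin n → List Colour) (ℓ∈ : ∀ v → ℓ v ∈ palette) (k : ℕ)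
    (traps : ∀ φ → φ ∈ B-colourings → k < trapped φ ℓ) where

    lists : Fin n → List Colour
    lists v = maybe′ id (ℓ v) (σ v)

    lists∈ : ∀ v → lists v ∈ palette
    lists∈ v = go (σ v) (σ∈ v)
      where
      go : ∀ st → st ∈ states → maybe′ id (ℓ v) st ∈ palette
      go (just S) S∈ = just-∈-states S∈
      go nothing  _  = ℓ∈ v

    module _ (φ : Fin n → Colour) (φ∈ : ∀ v → U v ≡ true → φ v ∈ lists v) where

      -- The trace of `φ` on B inside `U`, padded by `c₀` so that it fits `B-options`.
      on-B : Fin n → Colour
      on-B u = maybe′ (λ _ → if U u then φ u else c₀) c₀ (σ u)

      on-B∈ : ∀ u → on-B u ∈ B-options u
      on-B∈ u = go (σ u) (U u) (φ∈ u)
        where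
        go : ∀ (st : State) b → (b ≡ true → φ u ∈ maybe′ id (ℓ u) st) →
          maybe′ (λ _ → if b then φ u else c₀) c₀ st ∈ maybe′ (λ S → if b then S else c₀ ∷ []) (c₀ ∷ []) st
        go nothing  b     f = here refl
        go (just S) true  f = f refl
        go (just S) false f = here refl

      on-B≡ : ∀ u → U u ≡ true → B u ≡ true → on-B u ≡ φ u
      on-B≡ u Uu Bu = go (σ u) (U u) Uu Bu
        where
        go : ∀ (st : State) b → b ≡ true → is-just st ≡ true →
          maybe′ (λ _ → if b then φ u else c₀) c₀ st ≡ φ u
        go (just S) true _ _ = refl

      ∉B⇒∈ℓ : ∀ a → U a ≡ true → B a ≡ false → φ a ∈ ℓ a
      ∉B⇒∈ℓ a Ua Ba = go (σ a) Ba (φ∈ a Ua)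
        where
        go : ∀ (st : State) → is-just st ≡ false → φ a ∈ maybe′ id (ℓ a) st → φ a ∈ ℓ a
        go nothing _ p = p

      -- The colour of `a` comes from `ℓ a`, whose colours are all frequent under `ψ`. On B inside
      -- `U` the colouring `ψ` is `φ`, so the neighbours counted there are joined to `a` by
      -- monochromatic edges.
      mono-row : ∀ ψ → (∀ u → ψ u ≡ on-B u) → ∀ a → (good a ∧ all (frequent ψ a) (ℓ a)) ≡ true →
        t ≤ ∑ V λ u → 𝟙 (mono φ a u)
      mono-row ψ ψ≡ a e = ≤-trans (<⇒≤ (frequent⇒ (all-∈ (frequent ψ a) (proj₂ parts) (∉B⇒∈ℓ a Ua Ba))))
        (∑-mono V λ u → 𝟙-≤ ((nb a u ∧ B u) ∧ does (ψ u ≟ φ a)) (point u))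
        where
        parts = ∧-true⁻ {good a} e
        Ua : U a ≡ true
        Ua = proj₁ (∧-true⁻ {U a} (proj₁ parts))
        not-true : ∀ {b} → not b ≡ true → b ≡ false
        not-true {false} _ = refl
        Ba : B a ≡ false
        Ba = not-true (proj₁ (∧-true⁻ {not (B a)} (proj₂ (∧-true⁻ {U a} (proj₁ parts)))))
        frequent⇒ : ∀ {x} → frequent ψ a x ≡ true → t < count ψ a x
        frequent⇒ {x} f = ≤ᵇ-false (count ψ a x) t (not-true f)
        point : ∀ u → ((nb a u ∧ B u) ∧ does (ψ u ≟ φ a)) ≡ true → 1 ≤ 𝟙 (mono φ a u)
        point u f = ≤-reflexive (sym (cong 𝟙 mono-true))
          where
          f₁ = ∧-true⁻ {nb a u ∧ B u} f
          f₂ = ∧-true⁻ {nb a u} (proj₁ f₁)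
          f₃ = ∧-true⁻ {U u} (proj₁ f₂)
          φa≡φu : φ a ≡ φ u
          φa≡φu = trans (sym (does-true (ψ u) (φ a) (proj₂ f₁)))
            (trans (ψ≡ u) (on-B≡ u (proj₁ f₃) (proj₂ f₂)))
          mono-true : mono φ a u ≡ true
          mono-true rewrite towards-true {a} {u} Ba (proj₂ f₂) | proj₂ f₃ | Ua | proj₁ f₃ | φa≡φu =
            does-refl (φ u)

      -- Summing over rows counts no edge twice, and more than k rows belong to trapped vertices.
      many-mono : k * t ≤ edges (mono φ)
      many-mono = from (choices-complete n B-options on-B on-B∈)
        where
        open ≤-Reasoning
        row : ∀ b {x} → (b ≡ true → t ≤ x) → 𝟙 b * t ≤ x
        row true  f = ≤-trans (≤-reflexive (+-identityʳ t)) (f refl)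
        row false f = z≤n
        from : (∃ λ ψ → ψ ∈ B-colourings × (∀ u → ψ u ≡ on-B u)) → k * t ≤ edges (mono φ)
        from (ψ , ψ∈ , ψ≡) = begin
            k * t
          ≤⟨ *-monoˡ-≤ t (<⇒≤ (traps ψ ψ∈)) ⟩
            trapped ψ ℓ * t
          ≡⟨ ∑-*ʳ V t _ ⟨
            ∑ V (λ a → 𝟙 (good a ∧ all (frequent ψ a) (ℓ a)) * t)
          ≤⟨ ∑-mono V (λ a → row (good a ∧ all (frequent ψ a) (ℓ a)) (mono-row ψ ψ≡ a)) ⟩
            edges (mono φ)
          ∎

    module _ (s>0 : 0 < s) (order>0 : 0 < order) (enough : (2 * s + 6) * order ≤ k * t) where

      -- Shifted by one because list entries must be positive.
      colour : Colour → ℕ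
      colour x = suc (toℕ x)

      -- The same lists of size s refute k-dichoosability for every k ≤ s, as the lower bound s + 1
      -- demands.
      list-assignment : ∀ {k} → k ≤ s → ListAssignment {n} k
      list-assignment k≤s = record
        { L        = λ v → map colour (lists v)
        ; nodup    = λ v → Unique.map⁺ (toℕ-injective ∘ suc-injective)
                       (combs-Unique s (lists∈ v) (Unique.allFin⁺ q))
        ; positive = λ v → Allₚ.map⁺ (All.universal (λ _ → s≤s z≤n) (lists v))
        ; size     = λ v → ≤-trans k≤s (≤-reflexive (sym
                       (trans (length-map colour (lists v)) (combs-length s {allFin q} (lists∈ v)))))
        }

      dichoosability≥ : GraphDichoosabilityAtLeast G (suc s)
      dichoosability≥ = from (orientation s>0 order>0 c₀ lists (λ v → combs-length s {allFin q} (lists∈ v))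
          (λ φ φ∈ → ≤-trans enough (many-mono φ φ∈)))
        where
        from : (Σ (Digraph n) λ D → IsOrientation G D ×
          (∀ (φ : Fin n → Colour) → (∀ v → U v ≡ true → φ v ∈ lists v) →
            Σ (DirectedCycle D) λ Γ → ∃ λ c → All (λ v → φ v ≡ c) (DirectedCycle.vertices Γ))) →
          GraphDichoosabilityAtLeast G (suc s)
        from (D , D-orients , cyclic) = D , D-orients , λ k dich → ≮⇒≥ λ k<suc-s →
            refute (s≤s⁻¹ k<suc-s) (dich (list-assignment (s≤s⁻¹ k<suc-s)))
          where
          refute : ∀ {k} (k≤s : k ≤ s) → (∃ λ φ → IsLDicolouring D (list-assignment k≤s) φ) → ⊥
          refute k≤s (φ , φ∈ , acyclic) =
            contra (cyclic (λ v → proj₁ (∈-map⁻ colour (φ∈ v)))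
              (λ v _ → proj₁ (proj₂ (∈-map⁻ colour (φ∈ v)))))
            where
            contra : (Σ (DirectedCycle D) λ Γ → ∃ λ c →
                All (λ v → proj₁ (∈-map⁻ colour (φ∈ v)) ≡ c) (DirectedCycle.vertices Γ)) → ⊥
            contra (Γ , c , al) = acyclic (colour c) Γ
              (All.map (λ {v} e → trans (proj₂ (proj₂ (∈-map⁻ colour (φ∈ v)))) (cong colour e)) al)

-- Choice of the parameters and numerical estimates

module Parameters (s : ℕ) (s>0 : 0 < s) where

  instance
    s≢0 : NonZero s
    s≢0 = >-nonZero s>0

  -- A uniform s-list lies in a given half of the palette with probability at least 1 / P. The value
  -- of Q makes s |B| small against |U| / P, which pays for the s^|B| colourings of B, and t makes
  -- the |U| / (64 P) trapped vertices yield (2s + 6) |U| monochromatic edges.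
  h P Q t q R d : ℕ
  h = 2 * (s * s)
  P = 2 ^ suc s
  Q = 32 * (s * P)
  t = 64 * P * (2 * s + 6)
  q = 2 * h
  R = q * t
  -- Half of the assumed average degree for r = s + 1, which is the minimum degree retained in the
  -- core.
  d = suc s ^ 7 * 2 ^ (3 * suc s + 16)

  P>0 : 0 < P
  P>0 = m^n>0 2 (suc s)

  Q>0 : 0 < Q
  Q>0 = *-mono-≤ {1} {32} (s≤s z≤n) (*-mono-≤ s>0 P>0)

  s≤h : s ≤ h
  s≤h = ≤-trans (m≤m*n s s) (m≤m+n (s * s) (s * s + 0))

  open ≤-Reasoning

  Q2^q≤2^R : Q * 2 ^ q ≤ 2 ^ R
  Q2^q≤2^R = begin
      Q * 2 ^ q           ≤⟨ *-monoˡ-≤ (2 ^ q) (<⇒≤ (n<2^n Q)) ⟩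
      2 ^ Q * 2 ^ q       ≡⟨ ^-distribˡ-+-* 2 Q q ⟨
      2 ^ (Q + q)         ≤⟨ ^-monoʳ-≤ 2 Q+q≤R ⟩
      2 ^ R               ∎
    where
    l₁ : ∀ s p → 32 * (s * p) + 2 * (2 * (s * s)) ≡ s * (32 * p + 4 * s)
    l₁ = solve-∀
    l₂ : ∀ s p → s * (32 * s * p + 4 * s * p) + (s * s * p * (512 * s + 1500))
       ≡ 2 * (2 * (s * s)) * (64 * p * (2 * s + 6))
    l₂ = solve-∀
    Q+q≤R : Q + q ≤ R
    Q+q≤R = begin
        Q + q                                   ≡⟨ l₁ s P ⟩
        s * (32 * P + 4 * s)                    ≤⟨ *-monoʳ-≤ s (+-mono-≤ (*-monoˡ-≤ P (*-monoʳ-≤ 32 s>0))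
                                                     (m≤m*n (4 * s) P {{>-nonZero P>0}})) ⟩
        -- The added term is the exact difference to `R`.
        s * (32 * s * P + 4 * s * P)            ≤⟨ m≤m+n _ (s * s * P * (512 * s + 1500)) ⟩
        s * (32 * s * P + 4 * s * P) + s * s * P * (512 * s + 1500)  ≡⟨ l₂ s P ⟩
        R                                       ∎

  -- The left side is s³(s+3) · P³ · 2^16. The three factors P = 2^r come from `Q`, from `P` itself
  -- and from `t` inside `R`; they account for 2^(3r) in the theorem.
  2QP2R≤d : 2 * (Q * P) * (2 * R) ≤ d
  2QP2R≤d = begin
      2 * (Q * P) * (2 * R)                             ≡⟨ l₁ s P ⟩
      s ^ 3 * (s + 3) * (P * (P * P)) * 2 ^ 16          ≤⟨ *-monoˡ-≤ (2 ^ 16) (*-monoˡ-≤ (P * (P * P)) poly) ⟩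
      suc s ^ 7 * (P * (P * P)) * 2 ^ 16                ≡⟨ cong (λ z → suc s ^ 7 * z * 2 ^ 16) P³ ⟩
      suc s ^ 7 * 2 ^ (3 * suc s) * 2 ^ 16              ≡⟨ *-assoc (suc s ^ 7) (2 ^ (3 * suc s)) (2 ^ 16) ⟩
      suc s ^ 7 * (2 ^ (3 * suc s) * 2 ^ 16)            ≡⟨ cong (suc s ^ 7 *_) (^-distribˡ-+-* 2 (3 * suc s) 16) ⟨
      d                                                 ∎
    where
    l₁ : ∀ s p → 2 * (32 * (s * p) * p) * (2 * (2 * (2 * (s * s)) * (64 * p * (2 * s + 6))))
               ≡ s * (s * (s * 1)) * (s + 3) * (p * (p * p)) * 65536
    l₁ = solve-∀
    P³ : P * (P * P) ≡ 2 ^ (3 * suc s)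
    P³ = trans (cong (λ z → P * (P * z)) (sym (*-identityʳ P)))
      (trans (^-*-assoc 2 (suc s) 3) (cong (2 ^_) (*-comm (suc s) 3)))
    poly : s ^ 3 * (s + 3) ≤ suc s ^ 7
    poly = begin
        s ^ 3 * (s + 3)             ≤⟨ *-mono-≤ (^-monoˡ-≤ 3 (n≤1+n s)) s+3≤ ⟩
        suc s ^ 3 * suc s ^ 4       ≡⟨ ^-distribˡ-+-* (suc s) 3 4 ⟨
        suc s ^ 7                   ∎
      where
      l₃ : ∀ s → (1 + s) * ((1 + s) * ((1 + s) * ((1 + s) * 1)))
         ≡ s + 1 + (3 * s + s * s * (6 + 4 * s + s * s))
      l₃ = solve-∀
      s+3≤ : s + 3 ≤ suc s ^ 4
      s+3≤ = begin
          s + 3                                               ≡⟨ +-assoc s 1 2 ⟨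
          s + 1 + 2 * 1
        ≤⟨ +-monoʳ-≤ (s + 1) (≤-trans (*-mono-≤ {2} {3} (s≤s (s≤s z≤n)) s>0) (m≤m+n (3 * s) _)) ⟩
          s + 1 + (3 * s + s * s * (6 + 4 * s + s * s))       ≡⟨ l₃ s ⟨
          suc s ^ 4                                           ∎

  -- Applied with N the order of the core, x the cost of the sample and g the number of good
  -- vertices. The number k of trapped vertices lies between N/(64P) and N/(32P), and N ≥ d ensures
  -- that it is positive.
  module Threshold (N x g : ℕ)
    (N≥d : d ≤ N) (Qx≤2N : Q * x ≤ 2 * N) (N≤g+x : N ≤ g + x) where

    instance
      32P≢0 : NonZero (32 * P)
      32P≢0 = >-nonZero (*-mono-≤ {1} {32} (s≤s z≤n) P>0)

    k : ℕ
    k = N / (32 * P)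

    32Pk≤N : 32 * P * k ≤ N
    32Pk≤N = ≤-trans (≤-reflexive (*-comm (32 * P) k)) (m/n*n≤m N (32 * P))

    N<32P[1+k] : N < 32 * P * suc k
    N<32P[1+k] = begin-strict
        N                                     ≡⟨ m≡m%n+[m/n]*n N (32 * P) ⟩
        N % (32 * P) + k * (32 * P)           <⟨ +-monoˡ-< (k * (32 * P)) (m%n<n N (32 * P)) ⟩
        32 * P + k * (32 * P)                 ≡⟨ *-comm (suc k) (32 * P) ⟩
        32 * P * suc k                        ∎

    32P≤N : 32 * P ≤ N
    32P≤N = begin
        32 * P                                ≤⟨ *-monoʳ-≤ 32 (m≤n*m P s) ⟩
        Q                                     ≤⟨ m≤m*n Q P {{>-nonZero P>0}} ⟩
        Q * P                                 ≤⟨ m≤n*m (Q * P) 2 ⟩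
        2 * (Q * P)                           ≤⟨ m≤m*n (2 * (Q * P)) (2 * R) {{>-nonZero 2R>0}} ⟩
        2 * (Q * P) * (2 * R)                 ≤⟨ 2QP2R≤d ⟩
        d                                     ≤⟨ N≥d ⟩
        N                                     ∎
      where
      2R>0 : 0 < 2 * R
      2R>0 = *-mono-≤ {1} {2} (s≤s z≤n) (*-mono-≤ {1} {q} {1} {t}
        (*-mono-≤ {1} {2} (s≤s z≤n) (≤-trans s>0 s≤h))
        (*-mono-≤ {1} {64 * P} {1} {2 * s + 6} (*-mono-≤ {1} {64} (s≤s z≤n) P>0)
          (≤-trans (s≤s z≤n) (m≤n+m 6 (2 * s)))))

    k>0 : 0 < k
    k>0 = n≢0⇒n>0 λ k≡0 → <⇒≱ N<32P[1+k]
      (≤-trans (≤-reflexive (trans (cong (λ z → 32 * P * suc z) k≡0) (*-identityʳ (32 * P)))) 32P≤N)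

    N≤64Pk : N ≤ 64 * P * k
    N≤64Pk = begin
        N                                     ≤⟨ <⇒≤ N<32P[1+k] ⟩
        32 * P * suc k                        ≤⟨ *-monoʳ-≤ (32 * P) (+-monoˡ-≤ k k>0) ⟩
        32 * P * (k + k)                      ≡⟨ l P k ⟩
        64 * P * k                            ∎
      where
      l : ∀ p k → 32 * p * (k + k) ≡ 64 * p * k
      l = solve-∀

    sx≤4k : s * x ≤ 4 * k
    sx≤4k = *-cancelˡ-≤ (32 * P) (begin
        32 * P * (s * x)                      ≡⟨ l₁ P s x ⟩
        Q * x                                 ≤⟨ Qx≤2N ⟩
        2 * N                                 ≤⟨ *-monoʳ-≤ 2 N≤64Pk ⟩
        2 * (64 * P * k)                      ≡⟨ l₂ P k ⟩
        32 * P * (4 * k)                      ∎)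
      where
      l₁ : ∀ p s x → 32 * p * (s * x) ≡ 32 * (s * p) * x
      l₁ = solve-∀
      l₂ : ∀ p k → 2 * (64 * p * k) ≡ 32 * p * (4 * k)
      l₂ = solve-∀

    -- As Q ≥ 4, the cost is at most N/2. Hence at least N/2 ≥ 16Pk vertices are good.
    2P8k≤g : 2 * P * (8 * k) ≤ g
    2P8k≤g = *-cancelˡ-≤ 2 (+-cancelʳ-≤ (2 * x) _ _ (begin
        2 * (2 * P * (8 * k)) + 2 * x         ≡⟨ cong (_+ 2 * x) (l P k) ⟩
        32 * P * k + 2 * x                    ≤⟨ +-mono-≤ 32Pk≤N 2x≤N ⟩
        N + N                                 ≡⟨ cong (N +_) (+-identityʳ N) ⟨
        2 * N                                 ≤⟨ *-monoʳ-≤ 2 N≤g+x ⟩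
        2 * (g + x)                           ≡⟨ *-distribˡ-+ 2 g x ⟩
        2 * g + 2 * x                         ∎))
      where
      l : ∀ p k → 2 * (2 * p * (8 * k)) ≡ 32 * p * k
      l = solve-∀
      2x≤N : 2 * x ≤ N
      2x≤N = *-cancelˡ-≤ 2 (begin
          2 * (2 * x)                         ≡⟨ *-assoc 2 2 x ⟨
          4 * x
        ≤⟨ *-monoˡ-≤ x (≤-trans (m≤m+n 4 28) (m≤m*n 32 (s * P) {{>-nonZero (*-mono-≤ s>0 P>0)}})) ⟩
          Q * x                               ≤⟨ Qx≤2N ⟩
          2 * N                               ∎)

    enough : (2 * s + 6) * N ≤ k * t
    enough = begin
        (2 * s + 6) * N                       ≤⟨ *-monoʳ-≤ (2 * s + 6) N≤64Pk ⟩
        (2 * s + 6) * (64 * P * k)            ≡⟨ l (2 * s + 6) (64 * P) k ⟩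
        k * t                                 ∎
      where
      l : ∀ a b k → a * (b * k) ≡ k * (b * a)
      l = solve-∀

-- From average degree to list dichromatic number

module _ (s : ℕ) (s>0 : 0 < s) where

  open Parameters s s>0

  dichoosability-lower-bound : ∀ G → AdAtLeast G (2 * d) → GraphDichoosabilityAtLeast G (suc s)
  dichoosability-lower-bound G dense = from-core (Core.min-degree-core G d d>0 dense)
    where
    d>0 : 0 < d
    d>0 = *-mono-≤ {1} {suc s ^ 7} (m^n>0 (suc s) 7) (m^n>0 2 (3 * suc s + 16))
    from-core : (∃ λ U → 0 < Core.size G U × (∀ v → U v ≡ true → d ≤ Core.degIn G U v)) →
      GraphDichoosabilityAtLeast G (suc s)
    from-core (U , order>0 , min-degree) = from-sample (cheap-sample d 2QP2R≤d Q2^q≤2^R min-degree)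
      where
      halve : (2 * h) C s ≤ P * (h C s)
      halve = C-halve s h s>0 ≤-refl
      open Lists G U h s P Q t s≤h P>0 Q>0 halve using
        (State; states; samples; cost; order; V; palette; cheap-sample; module Extend)
      -- A vertex of the nonempty core already has d neighbours inside it.
      order≥d : d ≤ order
      order≥d = let v , _ , p = ∑-pos⇒∃ V (𝟙 ∘ U) order>0
        in ≤-trans (min-degree v (𝟙-pos (U v) p)) (∑-mono V λ u → le (U u) (adj G v u))
        where
        le : ∀ a b → 𝟙 (a ∧ b) ≤ 𝟙 a
        le false b = z≤n
        le true  b = 𝟙≤1 b
      c₀ : Fin q
      c₀ = fromℕ< {0} (*-mono-≤ {1} {2} (s≤s z≤n) (≤-trans s>0 s≤h))
      from-sample : (∃ λ σ → σ ∈ samples × Q * cost σ ≤ 2 * order) → GraphDichoosabilityAtLeast G (suc s)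
      from-sample (σ , σ∈′ , cheap) = from-lists (Ext.trapping-lists k k>0 sx≤4k 2P8k≤g)
        where
        σ∈ : ∀ v → σ v ∈ states
        σ∈ = ∈-choices⁻ _ (λ _ → states) σ∈′
        module Ext = Extend σ σ∈ c₀
        open Threshold order (cost σ) Ext.#good order≥d cheap Ext.order≤
        from-lists : (∃ λ ℓ → ℓ ∈ Ext.assignments × (∀ φ → φ ∈ Ext.B-colourings → k < Ext.trapped φ ℓ)) →
          GraphDichoosabilityAtLeast G (suc s)
        from-lists (ℓ , ℓ∈ , traps) =
          Colouring.dichoosability≥ G U h s P Q t s≤h P>0 Q>0 halve σ σ∈ c₀ ℓ
            (∈-choices⁻ _ (λ _ → palette) ℓ∈) k traps s>0 order>0 enough

theorem3p3 : Σ ℕ λ r₀ → ∀ (r : ℕ) → r ≥ r₀ → ∀ (G : Graph) →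
    AdAtLeast G ((r ^ 7) * (2 ^ (3 * r + 17))) →
    GraphDichoosabilityAtLeast G r
-- With r₀ = 2 the number s = r - 1 is positive, as the parameters require.
theorem3p3 = 2 , λ { (suc s) (s≤s s>0) G dense →
  dichoosability-lower-bound s s>0 G (subst (AdAtLeast G) (twice (suc s ^ 7) (3 * suc s)) dense) }
  where
  twice : ∀ a e → a * 2 ^ (e + 17) ≡ 2 * (a * 2 ^ (e + 16))
  twice a e = trans (cong (λ z → a * 2 ^ z) (+-suc e 16)) (lem a (2 ^ (e + 16)))
    where
    lem : ∀ a b → a * (2 * b) ≡ 2 * (a * b)
    lem = solve-∀
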